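{- The homomorphism $\hat\omega:\mathscr{P}^{S_\infty}(\mathbb{Z})\to\mathscr{P}^{S_\infty}(\mathbb{Z})$ defined by $\hat\omega(e_n)=h_n$ ($n\ge1$) and $\hat\omega(\tilde e_n)=\tilde h_n$ ($n\ge0$) is an involution, i.e. $\hat\omega^2=1$. Equivalently, $\hat\omega(h_n)=e_n$ and $\hat\omega(\tilde h_n)=\tilde e_n$ for all $n$.
   Context: Let $x_1,x_2,\dots$ be commuting variables and $\theta_1,\theta_2,\dots$ anticommuting variables ($\theta_i\theta_j=-\theta_j\theta_i$, $\theta_i^2=0$) commuting with the $x_i$. $\mathscr{P}^{S_\infty}(\mathbb{Z})$ is the ring of formal series of bounded degree with integer coefficients in $(x,\theta)$ invariant under simultaneous permutations of the pairs $(x_i,\theta_i)$. Elements $e_n,\tilde e_n,h_n,\tilde h_n$ of this ring are defined by $$\sum_{n\ge0}t^n(e_n+\tau\tilde e_n)=\prod_{i\ge1}(1+tx_i+\tau\theta_i),\qquad \sum_{n\ge0}t^n(h_n+\tau\tilde h_n)=\prod_{i\ge1}\frac1{1-tx_i-\tau\theta_i},$$ where $t$ is a commuting parameter and $\tau$ an anticommuting parameter (anticommuting also with the $\theta_i$). The ring $\mathscr{P}^{S_\infty}(\mathbb{Z})$ is freely generated, as a supercommutative ring, by the even elements $e_n$ ($n\ge1$) and the odd elements $\tilde e_n$ ($n\ge0$), so $\hat\omega$ is well defined as a ring homomorphism. -}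

module Defs where

open import Algebra.Bundles using (Ring; CommutativeRing)
import Data.Bool as Bool
open import Data.Bool using (Bool; true; false; _∧_; _xor_; if_then_else_)
open import Data.Bool.Properties using (∧-comm; ∧-zeroʳ; xor-comm; xor-assoc; xor-same; xor-identityʳ; xor-∧-commutativeRing)
open import Data.Fin using (Fin; zero; suc; _<?_; punchIn; toℕ)
open import Data.Fin.Permutation as Perm using (Permutation′; _⟨$⟩ʳ_; _⟨$⟩ˡ_)
open import Data.Integer using (ℤ; _+_; _*_; -_; _-_; 0ℤ; 1ℤ)
open import Data.Integer.Properties using (+-assoc; +-comm; +-identityˡ; +-identityʳ; +-inverseˡ; +-inverseʳ; *-assoc; *-comm; *-zeroˡ; *-zeroʳ; *-identityˡ; *-distribˡ-+; *-distribʳ-+; neg-distrib-+; neg-involutive; neg-distribˡ-*; neg-distribʳ-*)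
open import Data.List using (List; []; _∷_; _∷ʳ_; length)
open import Data.Nat as ℕ using (ℕ; zero; suc; _≤_; _<_; s≤s; z≤n)
import Data.Nat.Properties as ℕₚ
open import Data.Product using (_×_; _,_; proj₁; proj₂; ∃)
open import Data.Product.Properties using (≡-dec)
open import Data.Sum using (inj₁; inj₂)
open import Data.Vec as Vec using (Vec; lookup; tabulate; toList; fromList; insertAt)
open import Data.Vec.Properties using (lookup∘tabulate; tabulate-cong; tabulate∘lookup; insertAt-lookup; insertAt-punchIn; toList∘fromList)
open import Function using (_∘_)
open import Level using (0ℓ)
open import Relation.Binary.PropositionalEquality
open import Relation.Nullary using (Dec; does; yes; no; contradiction)

module Xor = CommutativeRing xor-∧-commutativeRing

open import Algebra.Properties.CommutativeMonoid.Sum Xor.+-commutativeMonoid using (sum; sum-cong-≗; sum-permute; sum-replicate-zero)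

-- (a , ε) stands for x^a θ^ε, where x and θ form one of the pairs of variables.
Slot : Set
Slot = ℕ × Bool

-- v₁ ∷ … ∷ vₙ ∷ [] stands for the ordered product x₁^a₁ θ₁^ε₁ ⋯ xₙ^aₙ θₙ^εₙ.
-- Trailing (0 , false) slots do not change the monomial; see Stable.
Mon : Set
Mon = List Slot

Series : Set
Series = Mon → ℤ

odd : Slot → Bool
odd = proj₂

-- The number of θ's, modulo 2.
parity : Mon → Bool
parity []      = false
parity (v ∷ m) = odd v xor parity m

degₛ : Slot → ℕ
degₛ (a , ε) = a ℕ.+ (if ε then 1 else 0)

deg : Mon → ℕ
deg []      = 0
deg (v ∷ m) = degₛ v ℕ.+ deg m

infixr 8 [-1]^_·_
[-1]^_·_ : Bool → ℤ → ℤ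
[-1]^ false · z = z
[-1]^ true  · z = - z

-- ∑₊ T a is the sum of T i j over i + j = a; ∑ₛ T v is the sum of T u w over
-- the factorisations v = u w, in which at most one factor contains θ.
∑₊ : (ℕ → ℕ → ℤ) → ℕ → ℤ
∑₊ T zero    = T 0 0
∑₊ T (suc a) = T 0 (suc a) + ∑₊ (λ i j → T (suc i) j) a

∑ₑ : (Bool → Bool → ℤ) → Bool → ℤ
∑ₑ T false = T false false
∑ₑ T true  = T true false + T false true

∑ₛ : (Slot → Slot → ℤ) → Slot → ℤ
∑ₛ T (a , ε) = ∑₊ (λ i j → ∑ₑ (λ δ η → T (i , δ) (j , η)) ε) a

infix 9 _⟨_⟩
_⟨_⟩ : Series → Slot → Series
(f ⟨ v ⟩) m = f (v ∷ m)

twist : Bool → Series → Series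
twist p f m = [-1]^ (p ∧ parity m) · f m

-- Writing f = ∑ u f⟨u⟩ and g = ∑ w g⟨w⟩ over the powers of the first pair of
-- variables, (u f⟨u⟩)(w g⟨w⟩) = u w f⟨u⟩ g⟨w⟩ up to the sign of moving w to the
-- left of f⟨u⟩, which twist records.
infixl 7 _⊛_
_⊛_ : Series → Series → Series
(f ⊛ g) []      = f [] * g []
(f ⊛ g) (v ∷ m) = ∑ₛ (λ u w → (twist (odd w) (f ⟨ u ⟩) ⊛ g ⟨ w ⟩) m) v

infixl 6 _⊕_ _⊖_
infix  8 ⊖_
_⊕_ _⊖_ : Series → Series → Series
(f ⊕ g) m = f m + g m
(f ⊖ g) m = f m - g m

⊖_ : Series → Series
(⊖ f) m = - f m

𝟘 𝟙 : Series
𝟘 _ = 0ℤ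
𝟙 []                   = 1ℤ
𝟙 ((zero , false) ∷ m) = 𝟙 m
𝟙 _                    = 0ℤ

Stable : Series → Set
Stable f = ∀ m → f (m ∷ʳ (0 , false)) ≡ f m

BoundedBy : ℕ → Series → Set
BoundedBy d f = ∀ m → d < deg m → f m ≡ 0ℤ

HasParity : Bool → Series → Set
HasParity p f = ∀ m → parity m ≢ p → f m ≡ 0ℤ

-- The substitution (xᵢ , θᵢ) ↦ (x_σ(i) , θ_σ(i)) sends the monomial m to
-- permute σ m times the sign of reordering the θ's, i.e. (-1) to the number of
-- pairs i < j with σ(i) > σ(j) and both θᵢ and θⱼ present in m.
permute : ∀ {n} → Permutation′ n → Vec Slot n → Vec Slot n
permute σ m = tabulate λ i → lookup m (σ ⟨$⟩ˡ i)

inversion : ∀ {n} → Permutation′ n → Vec Slot n → Fin n → Fin n → Bool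
inversion σ m i j = (does (i <? j) ∧ does (σ ⟨$⟩ʳ j <? σ ⟨$⟩ʳ i)) ∧ (odd (lookup m i) ∧ odd (lookup m j))

inversions : ∀ {n} → Permutation′ n → Vec Slot n → Bool
inversions σ m = sum λ i → sum λ j → inversion σ m i j

-- Invariance under S_n for every n.
Invariant : Series → Set
Invariant f = ∀ {n} (σ : Permutation′ n) (m : Vec Slot n) →
  f (toList (permute σ m)) ≡ [-1]^ inversions σ m · f (toList m)

infixr 8 _^_
_^_ : Series → ℕ → Series
f ^ zero  = 𝟙
f ^ suc k = f ⊛ f ^ k

geo : Series → ℕ → Series
geo u zero    = 𝟙
geo u (suc d) = geo u d ⊕ u ^ suc d

-- 1/f = ∑ₖ (1 - f)^k for f with constant term 1; the k-th power has no terms of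
-- degree below k.  See recip-inverseʳ.
recip : Series → Series
recip f m = geo (𝟙 ⊖ f) (deg m) m

∏ : (ℕ → Series) → ℕ → Series
∏ F zero    = 𝟙
∏ F (suc n) = ∏ F n ⊛ F n

-- The infinite product, for F with F i ≡ 1 on monomials in the first i pairs of
-- variables; see FactorProperties.∏-limit.
∏∞ : (ℕ → Series) → Series
∏∞ F m = ∏ F (length m) m

_≟ₛ_ : (u v : Slot) → Dec (u ≡ v)
_≟ₛ_ = ≡-dec ℕ._≟_ Bool._≟_

-- The monomial v ≠ 1 in the j-th pair of variables.
gen : Slot → ℕ → Series
gen v zero    (u ∷ m)              = if does (u ≟ₛ v) then 𝟙 m else 0ℤ
gen v (suc j) ((zero , false) ∷ m) = gen v j m
gen v _       _                    = 0ℤ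

-- The generating functions are series in (t , τ), (x₁ , θ₁), (x₂ , θ₂), …: the
-- parameters are the pair of variables of index 0, so x i is x_(i+1).
t τ : Series
t = gen (1 , false) 0
τ = gen (0 , true) 0

x θ : ℕ → Series
x i = gen (1 , false) (suc i)
θ i = gen (0 , true) (suc i)

factorE factorH : ℕ → Series
factorE i = 𝟙 ⊕ t ⊛ x i ⊕ τ ⊛ θ i
factorH i = recip (𝟙 ⊖ t ⊛ x i ⊖ τ ⊛ θ i)

sgn-+ : ∀ p x y → [-1]^ p · (x + y) ≡ [-1]^ p · x + [-1]^ p · y
sgn-+ false x y = refl
sgn-+ true  x y = neg-distrib-+ x y

sgn-*ˡ : ∀ p x y → [-1]^ p · (x * y) ≡ ([-1]^ p · x) * y
sgn-*ˡ false x y = refl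
sgn-*ˡ true  x y = neg-distribˡ-* x y

sgn-*ʳ : ∀ p x y → [-1]^ p · (x * y) ≡ x * ([-1]^ p · y)
sgn-*ʳ false x y = refl
sgn-*ʳ true  x y = neg-distribʳ-* x y

sgn-0 : ∀ p → [-1]^ p · 0ℤ ≡ 0ℤ
sgn-0 false = refl
sgn-0 true  = refl

sgn-xor : ∀ p q x → [-1]^ (p xor q) · x ≡ [-1]^ p · [-1]^ q · x
sgn-xor false q     x = refl
sgn-xor true  false x = refl
sgn-xor true  true  x = sym (neg-involutive x)

sgn-comm : ∀ p q x → [-1]^ p · [-1]^ q · x ≡ [-1]^ q · [-1]^ p · x
sgn-comm p q x = trans (sym (sgn-xor p q x)) (trans (cong ([-1]^_· x) (xor-comm p q)) (sgn-xor q p x))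

sgn-sgn : ∀ p x → [-1]^ p · [-1]^ p · x ≡ x
sgn-sgn p x = trans (sym (sgn-xor p p x)) (cong ([-1]^_· x) (xor-same p))

interchange : ∀ a b c d → (a + b) + (c + d) ≡ (a + c) + (b + d)
interchange a b c d = trans (+-assoc a b (c + d)) (trans (cong (a +_) (trans (sym (+-assoc b c d)) (trans (cong (_+ d) (+-comm b c)) (+-assoc c b d)))) (sym (+-assoc a c (b + d))))

∑₊-cong : ∀ {T U} a → (∀ i j → i ℕ.+ j ≡ a → T i j ≡ U i j) → ∑₊ T a ≡ ∑₊ U a
∑₊-cong zero    h = h 0 0 refl
∑₊-cong (suc a) h = cong₂ _+_ (h 0 (suc a) refl) (∑₊-cong a (λ i j e → h (suc i) j (cong suc e)))

Additive : {X : Set} → ((X → ℤ) → ℤ) → Set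
Additive {X} L = ∀ (p q : X → ℤ) → L (λ x → p x + q x) ≡ L p + L q

∑₊-additive : {X : Set} (L : (X → ℤ) → ℤ) → Additive L → (T : ℕ → ℕ → X → ℤ) → ∀ a →
              L (λ x → ∑₊ (λ i j → T i j x) a) ≡ ∑₊ (λ i j → L (T i j)) a
∑₊-additive L add T zero    = refl
∑₊-additive L add T (suc a) =
  trans (add (T 0 (suc a)) _) (cong (L (T 0 (suc a)) +_) (∑₊-additive L add (λ i j → T (suc i) j) a))

∑ₑ-additive : {X : Set} (L : (X → ℤ) → ℤ) → Additive L → (T : Bool → Bool → X → ℤ) → ∀ ε →
              L (λ x → ∑ₑ (λ δ η → T δ η x) ε) ≡ ∑ₑ (λ δ η → L (T δ η)) ε
∑ₑ-additive L add T false = refl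
∑ₑ-additive L add T true  = add _ _

∑ₛ-additive : {X : Set} (L : (X → ℤ) → ℤ) → Additive L → (T : Slot → Slot → X → ℤ) → ∀ v →
              L (λ x → ∑ₛ (λ u w → T u w x) v) ≡ ∑ₛ (λ u w → L (T u w)) v
∑ₛ-additive L add T (a , ε) =
  trans (∑₊-additive L add _ a)
        (∑₊-cong a (λ i j _ → ∑ₑ-additive L add (λ δ η → T (i , δ) (j , η)) ε))

data Split : Slot → Slot → Slot → Set where
  ff : ∀ {i j} → Split (i ℕ.+ j , false) (i , false) (j , false)
  tf : ∀ {i j} → Split (i ℕ.+ j , true)  (i , true)  (j , false)
  ft : ∀ {i j} → Split (i ℕ.+ j , true)  (i , false) (j , true)

∑ₛ-cong : ∀ {T U} v → (∀ u w → Split v u w → T u w ≡ U u w) → ∑ₛ T v ≡ ∑ₛ U v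
∑ₛ-cong (a , false) h = ∑₊-cong a λ { i j refl → h _ _ ff }
∑ₛ-cong (a , true)  h = ∑₊-cong a λ { i j refl → cong₂ _+_ (h _ _ tf) (h _ _ ft) }

∑₊-+ : ∀ T U a → ∑₊ (λ i j → T i j + U i j) a ≡ ∑₊ T a + ∑₊ U a
∑₊-+ T U zero    = refl
∑₊-+ T U (suc a) = trans (cong (T 0 (suc a) + U 0 (suc a) +_) (∑₊-+ _ _ a)) (interchange (T 0 (suc a)) (U 0 (suc a)) _ _)

∑ₑ-+ : ∀ T U ε → ∑ₑ (λ i j → T i j + U i j) ε ≡ ∑ₑ T ε + ∑ₑ U ε
∑ₑ-+ T U false = refl
∑ₑ-+ T U true  = interchange (T true false) (U true false) _ _

∑ₛ-+ : ∀ T U v → ∑ₛ (λ u w → T u w + U u w) v ≡ ∑ₛ T v + ∑ₛ U v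
∑ₛ-+ T U (a , ε) = trans (∑₊-cong a (λ i j _ → ∑ₑ-+ _ _ ε)) (∑₊-+ _ _ a)

∑ₛ-sgn : ∀ p T v → [-1]^ p · ∑ₛ T v ≡ ∑ₛ (λ u w → [-1]^ p · T u w) v
∑ₛ-sgn p T v = ∑ₛ-additive {X = Slot} (λ z → [-1]^ p · z (0 , false)) (λ x y → sgn-+ p _ _) (λ u w _ → T u w) v

∑ₛ-fubini : ∀ (T : Slot → Slot → Slot → Slot → ℤ) v v′ →
  ∑ₛ (λ u w → ∑ₛ (λ u′ w′ → T u w u′ w′) v′) v ≡ ∑ₛ (λ u′ w′ → ∑ₛ (λ u w → T u w u′ w′) v) v′
∑ₛ-fubini T v v′ = ∑ₛ-additive {X = Slot × Slot} (λ t → ∑ₛ (λ u w → t (u , w)) v) (λ p q → ∑ₛ-+ _ _ v) (λ { u′ w′ (u , w) → T u w u′ w′ }) v′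

∑₊-snoc : ∀ T a → ∑₊ T (suc a) ≡ ∑₊ (λ i j → T i (suc j)) a + T (suc a) 0
∑₊-snoc T zero    = refl
∑₊-snoc T (suc a) = trans (cong (T 0 (2 ℕ.+ a) +_) (∑₊-snoc (λ i j → T (suc i) j) a)) (sym (+-assoc (T 0 (2 ℕ.+ a)) _ _))

∑₊-comm : ∀ T a → ∑₊ T a ≡ ∑₊ (λ i j → T j i) a
∑₊-comm T zero    = refl
∑₊-comm T (suc a) = trans (cong (T 0 (suc a) +_) (∑₊-comm _ a))
  (trans (+-comm (T 0 (suc a)) _) (sym (∑₊-snoc (λ i j → T j i) a)))

∑ₛ-comm : ∀ T v → ∑ₛ T v ≡ ∑ₛ (λ u w → T w u) v
∑ₛ-comm T (a , false) = ∑₊-comm _ a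
∑ₛ-comm T (a , true)  = trans (∑₊-comm _ a) (∑₊-cong a (λ i j _ → +-comm (T (j , true) (i , false)) _))

∑₊-assoc : ∀ (T : ℕ → ℕ → ℕ → ℤ) a →
  ∑₊ (λ i y → ∑₊ (λ j k → T i j k) y) a ≡ ∑₊ (λ y k → ∑₊ (λ i j → T i j k) y) a
∑₊-assoc T zero    = refl
∑₊-assoc T (suc a) = begin
  (T 0 0 (suc a) + ∑₊ (λ j k → T 0 (suc j) k) a) + ∑₊ (λ i y → ∑₊ (λ j k → T (suc i) j k) y) a
    ≡⟨ +-assoc (T 0 0 (suc a)) _ _ ⟩
  T 0 0 (suc a) + (∑₊ (λ j k → T 0 (suc j) k) a + ∑₊ (λ i y → ∑₊ (λ j k → T (suc i) j k) y) a)
    ≡⟨ cong (λ z → T 0 0 (suc a) + (∑₊ (λ j k → T 0 (suc j) k) a + z)) (∑₊-assoc (λ i → T (suc i)) a) ⟩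
  T 0 0 (suc a) + (∑₊ (λ j k → T 0 (suc j) k) a + ∑₊ (λ y k → ∑₊ (λ i j → T (suc i) j k) y) a)
    ≡⟨ cong (T 0 0 (suc a) +_) (∑₊-+ _ _ a) ⟨
  T 0 0 (suc a) + ∑₊ (λ y k → T 0 (suc y) k + ∑₊ (λ i j → T (suc i) j k) y) a ∎
  where open ≡-Reasoning

∑ₛ-assoc : ∀ (T : Slot → Slot → Slot → ℤ) v →
  ∑ₛ (λ u y → ∑ₛ (λ w z → T u w z) y) v ≡ ∑ₛ (λ y z → ∑ₛ (λ u w → T u w z) y) v
∑ₛ-assoc T (a , ε) = begin
  ∑₊ (λ i y → ∑ₑ (λ δ ζ → ∑₊ (λ j k → ∑ₑ (λ η θ → T (i , δ) (j , η) (k , θ)) ζ) y) ε) a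
    ≡⟨ ∑₊-cong a (λ i y _ → pull (λ δ ζ j k → ∑ₑ (λ η θ → T (i , δ) (j , η) (k , θ)) ζ) ε y) ⟩
  ∑₊ (λ i y → ∑₊ (λ j k → ∑ₑ (λ δ ζ → ∑ₑ (λ η θ → T (i , δ) (j , η) (k , θ)) ζ) ε) y) a
    ≡⟨ ∑₊-assoc _ a ⟩
  ∑₊ (λ y k → ∑₊ (λ i j → ∑ₑ (λ δ ζ → ∑ₑ (λ η θ → T (i , δ) (j , η) (k , θ)) ζ) ε) y) a
    ≡⟨ ∑₊-cong a (λ y k _ → ∑₊-cong y (λ i j _ → assocₑ (λ δ η θ → T (i , δ) (j , η) (k , θ)) ε)) ⟩
  ∑₊ (λ y k → ∑₊ (λ i j → ∑ₑ (λ ζ θ → ∑ₑ (λ δ η → T (i , δ) (j , η) (k , θ)) ζ) ε) y) a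
    ≡⟨ ∑₊-cong a (λ y k _ → pull (λ ζ θ i j → ∑ₑ (λ δ η → T (i , δ) (j , η) (k , θ)) ζ) ε y) ⟨
  ∑₊ (λ y k → ∑ₑ (λ ζ θ → ∑₊ (λ i j → ∑ₑ (λ δ η → T (i , δ) (j , η) (k , θ)) ζ) y) ε) a ∎
  where
  open ≡-Reasoning
  pull : ∀ (U : Bool → Bool → ℕ → ℕ → ℤ) ε y →
    ∑ₑ (λ δ ζ → ∑₊ (U δ ζ) y) ε ≡ ∑₊ (λ j k → ∑ₑ (λ δ ζ → U δ ζ j k) ε) y
  pull U false y = refl
  pull U true  y = sym (∑₊-+ _ _ y)
  assocₑ : ∀ (U : Bool → Bool → Bool → ℤ) ε →
    ∑ₑ (λ δ ζ → ∑ₑ (λ η θ → U δ η θ) ζ) ε ≡ ∑ₑ (λ ζ θ → ∑ₑ (λ δ η → U δ η θ) ζ) ε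
  assocₑ U false = refl
  assocₑ U true  = sym (+-assoc (U true false false) _ _)

data Splits : Mon → Mon → Mon → Set where
  []  : Splits [] [] []
  _∷_ : ∀ {v u w m p q} → Split v u w → Splits m p q → Splits (v ∷ m) (u ∷ p) (w ∷ q)

⊛-cong : ∀ m {f g f′ g′ : Series} → (∀ p q → Splits m p q → f p * g q ≡ f′ p * g′ q) →
         (f ⊛ g) m ≡ (f′ ⊛ g′) m
⊛-cong []      h = h [] [] []
⊛-cong (v ∷ m) {f} {g} {f′} {g′} h = ∑ₛ-cong v λ u w s → ⊛-cong m λ p q t →
  trans (sym (sgn-*ˡ (odd w ∧ parity p) (f (u ∷ p)) _))
    (trans (cong ([-1]^ (odd w ∧ parity p) ·_) (h (u ∷ p) (w ∷ q) (s ∷ t)))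
      (sgn-*ˡ (odd w ∧ parity p) (f′ (u ∷ p)) _))

⊛-congˡʳ : ∀ {f g f′ g′} → f ≗ f′ → g ≗ g′ → f ⊛ g ≗ f′ ⊛ g′
⊛-congˡʳ a b m = ⊛-cong m λ p q _ → cong₂ _*_ (a p) (b q)

⊛-congˡ : ∀ {f f′} g → f ≗ f′ → f ⊛ g ≗ f′ ⊛ g
⊛-congˡ g a = ⊛-congˡʳ {g = g} a (λ _ → refl)

⊛-congʳ : ∀ f {g g′} → g ≗ g′ → f ⊛ g ≗ f ⊛ g′
⊛-congʳ f b = ⊛-congˡʳ {f = f} (λ _ → refl) b

⊛-distribʳ : ∀ f g h → (f ⊕ g) ⊛ h ≗ (f ⊛ h) ⊕ (g ⊛ h)
⊛-distribʳ f g h []      = *-distribʳ-+ (h []) (f []) (g [])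
⊛-distribʳ f g h (v ∷ m) = trans (∑ₛ-cong v λ u w _ →
  trans (⊛-congˡ (h ⟨ w ⟩) (λ p → sgn-+ (odd w ∧ parity p) (f (u ∷ p)) (g (u ∷ p))) m)
    (⊛-distribʳ (twist (odd w) (f ⟨ u ⟩)) (twist (odd w) (g ⟨ u ⟩)) (h ⟨ w ⟩) m))
  (∑ₛ-+ _ _ v)

⊛-distribˡ : ∀ h f g → h ⊛ (f ⊕ g) ≗ (h ⊛ f) ⊕ (h ⊛ g)
⊛-distribˡ h f g []      = *-distribˡ-+ (h []) (f []) (g [])
⊛-distribˡ h f g (v ∷ m) = trans (∑ₛ-cong v λ u w _ → ⊛-distribˡ _ (f ⟨ w ⟩) (g ⟨ w ⟩) m) (∑ₛ-+ _ _ v)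

⊛-sgnˡ : ∀ p f g m → ((λ q → [-1]^ p · f q) ⊛ g) m ≡ [-1]^ p · (f ⊛ g) m
⊛-sgnˡ p f g []      = sym (sgn-*ˡ p (f []) _)
⊛-sgnˡ p f g (v ∷ m) = trans (∑ₛ-cong v λ u w _ →
  trans (⊛-congˡ (g ⟨ w ⟩) (λ q → sgn-comm (odd w ∧ parity q) p (f (u ∷ q))) m)
    (⊛-sgnˡ p (twist (odd w) (f ⟨ u ⟩)) (g ⟨ w ⟩) m)) (sym (∑ₛ-sgn p _ v))

⊛-sgnʳ : ∀ p f g m → (f ⊛ (λ q → [-1]^ p · g q)) m ≡ [-1]^ p · (f ⊛ g) m
⊛-sgnʳ p f g []      = sym (sgn-*ʳ p (f []) _)
⊛-sgnʳ p f g (v ∷ m) = trans (∑ₛ-cong v λ u w _ → ⊛-sgnʳ p _ (g ⟨ w ⟩) m) (sym (∑ₛ-sgn p _ v))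

⊛-∑ˡ : ∀ (T : Slot → Slot → Series) h v m →
  ((λ p → ∑ₛ (λ u w → T u w p) v) ⊛ h) m ≡ ∑ₛ (λ u w → (T u w ⊛ h) m) v
⊛-∑ˡ T h v m = ∑ₛ-additive (λ f → (f ⊛ h) m) (λ f g → ⊛-distribʳ f g h m) T v

⊛-∑ʳ : ∀ h (T : Slot → Slot → Series) v m →
  (h ⊛ (λ p → ∑ₛ (λ u w → T u w p) v)) m ≡ ∑ₛ (λ u w → (h ⊛ T u w) m) v
⊛-∑ʳ h T v m = ∑ₛ-additive (λ f → (h ⊛ f) m) (λ f g → ⊛-distribˡ h f g m) T v

∧-xor : ∀ p q r → p ∧ (q xor r) ≡ (p ∧ q) xor (p ∧ r)
∧-xor false q r = refl
∧-xor true  q r = refl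

twist-head : ∀ p f u m → twist p f (u ∷ m) ≡ [-1]^ (p ∧ odd u) · twist p (f ⟨ u ⟩) m
twist-head p f u m = trans (cong ([-1]^_· f (u ∷ m)) (∧-xor p (odd u) (parity m))) (sgn-xor (p ∧ odd u) _ _)

twist-comm : ∀ p q f → twist p (twist q f) ≗ twist q (twist p f)
twist-comm p q f m = sgn-comm (p ∧ parity m) (q ∧ parity m) (f m)

twist-cong : ∀ p {f g} → f ≗ g → twist p f ≗ twist p g
twist-cong p e m = cong ([-1]^ (p ∧ parity m) ·_) (e m)

split-odd : ∀ {v u w} → Split v u w → odd v ≡ odd u xor odd w
split-odd ff = refl
split-odd tf = refl
split-odd ft = refl

splits-parity : ∀ {m p q} → Splits m p q → parity m ≡ parity p xor parity q
splits-parity [] = refl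
splits-parity {v ∷ m} {u ∷ p} {w ∷ q} (s ∷ t) rewrite split-odd s | splits-parity t =
  shuffle (odd u) (odd w) (parity p) (parity q)
  where
  shuffle : ∀ a b c d → (a xor b) xor (c xor d) ≡ (a xor c) xor (b xor d)
  shuffle false false c d = refl
  shuffle false true  false d = refl
  shuffle false true  true  false = refl
  shuffle false true  true  true  = refl
  shuffle true false false d = refl
  shuffle true false true false = refl
  shuffle true false true true = refl
  shuffle true true false false = refl
  shuffle true true false true = refl
  shuffle true true true d = refl

twist-add : ∀ p q f → twist (p xor q) f ≗ twist p (twist q f)
twist-add p q f m = trans (cong ([-1]^_· f m) (e p q (parity m))) (sgn-xor (p ∧ parity m) _ _)
  where
  e : ∀ p q r → (p xor q) ∧ r ≡ (p ∧ r) xor (q ∧ r)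
  e p q r = trans (∧-comm (p xor q) r) (trans (∧-xor r p q) (cong₂ _xor_ (∧-comm r p) (∧-comm r q)))

⊛-twist : ∀ p f g → twist p (f ⊛ g) ≗ twist p f ⊛ twist p g
⊛-twist p f g [] rewrite ∧-zeroʳ p = refl
⊛-twist p f g (v ∷ m) = begin
  twist p (f ⊛ g) (v ∷ m)
    ≡⟨ ∑ₛ-sgn (p ∧ (odd v xor parity m)) _ v ⟩
  ∑ₛ (λ u w → [-1]^ (p ∧ (odd v xor parity m)) · (twist (odd w) (f ⟨ u ⟩) ⊛ g ⟨ w ⟩) m) v
    ≡⟨ ∑ₛ-cong v (λ u w s → lemma u w (split-odd s)) ⟩
  (twist p f ⊛ twist p g) (v ∷ m) ∎
  where
  open ≡-Reasoning
  lemma : ∀ u w → odd v ≡ odd u xor odd w →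
    [-1]^ (p ∧ (odd v xor parity m)) · (twist (odd w) (f ⟨ u ⟩) ⊛ g ⟨ w ⟩) m
    ≡ (twist (odd w) (twist p f ⟨ u ⟩) ⊛ (twist p g ⟨ w ⟩)) m
  lemma u w e = begin
    [-1]^ (p ∧ (odd v xor parity m)) · Z
      ≡⟨ cong (λ z → [-1]^ (p ∧ (z xor parity m)) · Z) e ⟩
    [-1]^ (p ∧ ((odd u xor odd w) xor parity m)) · Z
      ≡⟨ cong ([-1]^_· Z) (trans (∧-xor p (odd u xor odd w) _) (cong (_xor (p ∧ parity m)) (∧-xor p (odd u) (odd w)))) ⟩
    [-1]^ (((p ∧ odd u) xor (p ∧ odd w)) xor (p ∧ parity m)) · Z
      ≡⟨ trans (sgn-xor ((p ∧ odd u) xor (p ∧ odd w)) _ Z) (sgn-xor (p ∧ odd u) _ _) ⟩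
    [-1]^ (p ∧ odd u) · [-1]^ (p ∧ odd w) · twist p (F ⊛ G) m
      ≡⟨ cong (λ z → [-1]^ (p ∧ odd u) · [-1]^ (p ∧ odd w) · z) (⊛-twist p F G m) ⟩
    [-1]^ (p ∧ odd u) · [-1]^ (p ∧ odd w) · (twist p F ⊛ twist p G) m
      ≡⟨ cong ([-1]^ (p ∧ odd u) ·_) (⊛-sgnʳ (p ∧ odd w) (twist p F) (twist p G) m) ⟨
    [-1]^ (p ∧ odd u) · (twist p F ⊛ (λ q → [-1]^ (p ∧ odd w) · twist p G q)) m
      ≡⟨ ⊛-sgnˡ (p ∧ odd u) (twist p F) _ m ⟨
    ((λ q → [-1]^ (p ∧ odd u) · twist p F q) ⊛ (λ q → [-1]^ (p ∧ odd w) · twist p G q)) m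
      ≡⟨ ⊛-congˡʳ (λ q → sym (trans (twist-cong (odd w) (twist-head p f u) q) (trans (sgn-comm (odd w ∧ parity q) (p ∧ odd u) _) (cong ([-1]^ (p ∧ odd u) ·_) (twist-comm (odd w) p (f ⟨ u ⟩) q)))))
                  (λ q → sym (twist-head p g w q)) m ⟩
    (twist (odd w) (twist p f ⟨ u ⟩) ⊛ (twist p g ⟨ w ⟩)) m ∎
    where
    F = twist (odd w) (f ⟨ u ⟩)
    G = g ⟨ w ⟩
    Z = (F ⊛ G) m

⊛-assoc : ∀ f g h → (f ⊛ g) ⊛ h ≗ f ⊛ (g ⊛ h)
⊛-assoc f g h [] = *-assoc (f []) (g []) (h [])
⊛-assoc f g h (v ∷ m) = begin
  ∑ₛ (λ y z → (twist (odd z) ((f ⊛ g) ⟨ y ⟩) ⊛ h ⟨ z ⟩) m) v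
    ≡⟨ ∑ₛ-cong v (λ y z _ → trans (⊛-congˡ (h ⟨ z ⟩) (λ q → trans (∑ₛ-sgn (odd z ∧ parity q) _ y) (∑ₛ-cong y (λ u w _ → ⊛-twist (odd z) _ _ q))) m) (⊛-∑ˡ _ (h ⟨ z ⟩) y m)) ⟩
  ∑ₛ (λ y z → ∑ₛ (λ u w → ((twist (odd z) (twist (odd w) (f ⟨ u ⟩)) ⊛ twist (odd z) (g ⟨ w ⟩)) ⊛ h ⟨ z ⟩) m) y) v
    ≡⟨ ∑ₛ-assoc _ v ⟨
  ∑ₛ (λ u y → ∑ₛ (λ w z → ((twist (odd z) (twist (odd w) (f ⟨ u ⟩)) ⊛ twist (odd z) (g ⟨ w ⟩)) ⊛ h ⟨ z ⟩) m) y) v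
    ≡⟨ ∑ₛ-cong v (λ u y _ → ∑ₛ-cong y (λ w z s → trans (⊛-assoc _ _ (h ⟨ z ⟩) m)
         (⊛-congˡ _ (λ q → sym (trans (cong (λ b → twist b (f ⟨ u ⟩) q) (trans (split-odd s) (xor-comm (odd w) (odd z)))) (twist-add (odd z) (odd w) (f ⟨ u ⟩) q))) m))) ⟩
  ∑ₛ (λ u y → ∑ₛ (λ w z → (twist (odd y) (f ⟨ u ⟩) ⊛ (twist (odd z) (g ⟨ w ⟩) ⊛ h ⟨ z ⟩)) m) y) v
    ≡⟨ ∑ₛ-cong v (λ u y _ → ⊛-∑ʳ (twist (odd y) (f ⟨ u ⟩)) _ y m) ⟨
  (f ⊛ (g ⊛ h)) (v ∷ m) ∎
  where open ≡-Reasoning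

⊛-supercomm : ∀ p f g → HasParity p f → f ⊛ g ≗ twist p g ⊛ f
⊛-supercomm p f g fp [] = trans (*-comm (f []) (g []))
  (cong (λ b → ([-1]^ b · g []) * f []) (sym (∧-zeroʳ p)))
⊛-supercomm p f g fp (v ∷ m) = trans (∑ₛ-cong v step) (sym (∑ₛ-comm _ v))
  where
  parity′ : ∀ a b c → b ≢ c xor a → a xor b ≢ c
  parity′ false b false n e = n e
  parity′ false b true  n e = n e
  parity′ true false false n e = contradiction e λ ()
  parity′ true true  false n e = n refl
  parity′ true false true  n e = n refl
  parity′ true true  true  n e = contradiction e λ ()

  signs : ∀ {v u w} → Split v u w → ∀ p a →
    ((p xor odd u) ∧ a) xor (odd w ∧ (p xor odd u)) ≡ (odd u ∧ a) xor (p ∧ (odd w xor a))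
  signs ff false a     = refl
  signs ff true  false = refl
  signs ff true  true  = refl
  signs tf false false = refl
  signs tf false true  = refl
  signs tf true  false = refl
  signs tf true  true  = refl
  signs ft false false = refl
  signs ft false true  = refl
  signs ft true  false = refl
  signs ft true  true  = refl

  sgn-*₂ : ∀ a b x y → ([-1]^ a · x) * ([-1]^ b · y) ≡ [-1]^ (a xor b) · (x * y)
  sgn-*₂ a b x y = trans (sym (sgn-*ˡ a x _)) (trans (cong ([-1]^ a ·_) (sym (sgn-*ʳ b x y))) (sym (sgn-xor a b _)))

  step : ∀ u w → Split v u w →
    (twist (odd w) (f ⟨ u ⟩) ⊛ g ⟨ w ⟩) m ≡ (twist (odd u) (twist p g ⟨ w ⟩) ⊛ f ⟨ u ⟩) m
  step u w s = trans
    (⊛-supercomm (p xor odd u) (twist (odd w) (f ⟨ u ⟩)) (g ⟨ w ⟩)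
      (λ q n → trans (cong ([-1]^ (odd w ∧ parity q) ·_) (fp (u ∷ q) (parity′ (odd u) (parity q) p n))) (sgn-0 (odd w ∧ parity q))) m)
    (⊛-cong m λ a b _ → pointwise a b)
    where
    pointwise : ∀ a b → twist (p xor odd u) (g ⟨ w ⟩) a * twist (odd w) (f ⟨ u ⟩) b
                      ≡ twist (odd u) (twist p g ⟨ w ⟩) a * f (u ∷ b)
    pointwise a b with parity b Bool.≟ p xor odd u
    ... | yes e = begin
      ([-1]^ ((p xor odd u) ∧ parity a) · G) * ([-1]^ (odd w ∧ parity b) · F)
        ≡⟨ cong (λ z → ([-1]^ ((p xor odd u) ∧ parity a) · G) * ([-1]^ (odd w ∧ z) · F)) e ⟩
      ([-1]^ ((p xor odd u) ∧ parity a) · G) * ([-1]^ (odd w ∧ (p xor odd u)) · F)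
        ≡⟨ sgn-*₂ ((p xor odd u) ∧ parity a) (odd w ∧ (p xor odd u)) G F ⟩
      [-1]^ (((p xor odd u) ∧ parity a) xor (odd w ∧ (p xor odd u))) · (G * F)
        ≡⟨ cong ([-1]^_· (G * F)) (signs s p (parity a)) ⟩
      [-1]^ ((odd u ∧ parity a) xor (p ∧ (odd w xor parity a))) · (G * F)
        ≡⟨ sgn-*ˡ ((odd u ∧ parity a) xor (p ∧ (odd w xor parity a))) G F ⟩
      ([-1]^ ((odd u ∧ parity a) xor (p ∧ (odd w xor parity a))) · G) * F
        ≡⟨ cong (_* F) (sgn-xor (odd u ∧ parity a) _ G) ⟩
      twist (odd u) (twist p g ⟨ w ⟩) a * F ∎
      where
      open ≡-Reasoning
      G = g (w ∷ a)
      F = f (u ∷ b)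
    ... | no n rewrite fp (u ∷ b) (parity′ (odd u) (parity b) p n) | sgn-0 (odd w ∧ parity b) =
      trans (*-zeroʳ (twist (p xor odd u) (g ⟨ w ⟩) a)) (sym (*-zeroʳ (twist (odd u) (twist p g ⟨ w ⟩) a)))

⊛-comm-even : ∀ f g → HasParity false f → f ⊛ g ≗ g ⊛ f
⊛-comm-even f g = ⊛-supercomm false f g

⊛-vanish : ∀ m {f g} → (∀ p q → Splits m p q → f p * g q ≡ 0ℤ) → (f ⊛ g) m ≡ 0ℤ
⊛-vanish m {f} {g} h = trans (⊛-cong m {f′ = 𝟘} {g′ = 𝟘} (λ p q s → h p q s)) (zero⊛ m)
  where
  twist𝟘 : ∀ p → twist p 𝟘 ≗ 𝟘
  twist𝟘 p m = sgn-0 (p ∧ parity m)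
  ∑₊0 : ∀ T a → (∀ i j → T i j ≡ 0ℤ) → ∑₊ T a ≡ 0ℤ
  ∑₊0 T zero    z = z 0 0
  ∑₊0 T (suc a) z = trans (cong₂ _+_ (z 0 (suc a)) (∑₊0 _ a (λ i → z (suc i)))) refl
  zero⊛ : ∀ m → (𝟘 ⊛ 𝟘) m ≡ 0ℤ
  zero⊛ [] = refl
  zero⊛ ((a , false) ∷ m) = ∑₊0 _ a λ i j → zero⊛ m
  zero⊛ ((a , true)  ∷ m) = ∑₊0 _ a λ i j → cong₂ _+_ (zero⊛ m) (trans (⊛-congˡ 𝟘 (twist𝟘 true) m) (zero⊛ m))

∑ₛ-head : ∀ T v → (∀ u w → u ≢ (0 , false) → T u w ≡ 0ℤ) → ∑ₛ T v ≡ T (0 , false) v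
∑ₛ-head T (zero , false)  z = refl
∑ₛ-head T (zero , true)   z = trans (cong (_+ T (0 , false) (0 , true)) (z (0 , true) (0 , false) λ ())) (+-identityˡ _)
∑ₛ-head T (suc a , ε)     z = trans (cong₂ _+_ (first ε) (rest a (λ i j → inner ε i j))) (+-identityʳ _)
  where
  first : ∀ ε → ∑ₑ (λ δ η → T (0 , δ) (suc a , η)) ε ≡ T (0 , false) (suc a , ε)
  first false = refl
  first true  = trans (cong (_+ T (0 , false) (suc a , true)) (z (0 , true) (suc a , false) λ ())) (+-identityˡ _)
  inner : ∀ ε i j → ∑ₑ (λ δ η → T (suc i , δ) (j , η)) ε ≡ 0ℤ
  inner false i j = z _ _ λ ()
  inner true  i j = cong₂ _+_ (z (suc i , true) (j , false) λ ()) (z (suc i , false) (j , true) λ ())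
  rest : ∀ {U} a → (∀ i j → U i j ≡ 0ℤ) → ∑₊ U a ≡ 0ℤ
  rest zero    h = h 0 0
  rest (suc a) h = cong₂ _+_ (h 0 (suc a)) (rest a (λ i → h (suc i)))

𝟙-head : ∀ u m → u ≢ (0 , false) → 𝟙 (u ∷ m) ≡ 0ℤ
𝟙-head (zero , false) m n = contradiction refl n
𝟙-head (zero , true)  m n = refl
𝟙-head (suc _ , _)    m n = refl

𝟙-even : HasParity false 𝟙
𝟙-even []                   n = contradiction refl n
𝟙-even ((zero , false) ∷ m) n = 𝟙-even m n
𝟙-even ((zero , true)  ∷ m) n = refl
𝟙-even ((suc _ , _)    ∷ m) n = refl

twist-even : ∀ p f → HasParity false f → twist p f ≗ f
twist-even p f e m with parity m in eq
... | false rewrite ∧-zeroʳ p = refl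
... | true  rewrite e m (λ e′ → contradiction (trans (sym eq) e′) λ ()) = sgn-0 (p ∧ true)

⊛-identityˡ : ∀ g → 𝟙 ⊛ g ≗ g
⊛-identityˡ g []      = *-identityˡ (g [])
⊛-identityˡ g (v ∷ m) = trans
  (∑ₛ-head _ v λ u w n → ⊛-vanish m λ p q _ →
    trans (cong (λ z → ([-1]^ (odd w ∧ parity p) · z) * g (w ∷ q)) (𝟙-head u p n))
      (trans (cong (_* g (w ∷ q)) (sgn-0 (odd w ∧ parity p))) (*-zeroˡ (g (w ∷ q)))))
  (trans (⊛-congˡ (g ⟨ v ⟩) (twist-even (odd v) 𝟙 𝟙-even) m) (⊛-identityˡ (g ⟨ v ⟩) m))

⊛-identityʳ : ∀ g → g ⊛ 𝟙 ≗ g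
⊛-identityʳ g m = trans (sym (⊛-comm-even 𝟙 g 𝟙-even m)) (⊛-identityˡ g m)

+-interchange : ∀ a b c d → (a ℕ.+ b) ℕ.+ (c ℕ.+ d) ≡ (a ℕ.+ c) ℕ.+ (b ℕ.+ d)
+-interchange a b c d = trans (ℕₚ.+-assoc a b (c ℕ.+ d)) (trans (cong (a ℕ.+_) (trans (sym (ℕₚ.+-assoc b c d)) (trans (cong (ℕ._+ d) (ℕₚ.+-comm b c)) (ℕₚ.+-assoc c b d)))) (sym (ℕₚ.+-assoc a c (b ℕ.+ d))))

split-deg : ∀ {v u w} → Split v u w → degₛ v ≡ degₛ u ℕ.+ degₛ w
split-deg (ff {i} {j}) = +-interchange i j 0 0
split-deg (tf {i} {j}) = +-interchange i j 1 0
split-deg (ft {i} {j}) = +-interchange i j 0 1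

splits-deg : ∀ {m p q} → Splits m p q → deg m ≡ deg p ℕ.+ deg q
splits-deg [] = refl
splits-deg {p = u ∷ p} {w ∷ q} (s ∷ t) = trans (cong₂ ℕ._+_ (split-deg s) (splits-deg t)) (+-interchange (degₛ u) (degₛ w) (deg p) (deg q))

splits-length : ∀ {m p q} → Splits m p q → length p ≡ length m × length q ≡ length m
splits-length []      = refl , refl
splits-length (s ∷ t) = cong suc (proj₁ (splits-length t)) , cong suc (proj₂ (splits-length t))

zero-*ˡ : ∀ {x} y → x ≡ 0ℤ → x * y ≡ 0ℤ
zero-*ˡ y refl = *-zeroˡ y

zero-*ʳ : ∀ x {y} → y ≡ 0ℤ → x * y ≡ 0ℤ
zero-*ʳ x refl = *-zeroʳ x

⊛-bounded : ∀ {d e f g} → BoundedBy d f → BoundedBy e g → BoundedBy (d ℕ.+ e) (f ⊛ g)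
⊛-bounded {d} {e} {f} {g} F G m lt = ⊛-vanish m λ p q s → case p q (splits-deg s)
  where
  case : ∀ p q → deg m ≡ deg p ℕ.+ deg q → f p * g q ≡ 0ℤ
  case p q eq with deg p ℕ.≤? d
  ... | no n = zero-*ˡ (g q) (F p (ℕₚ.≰⇒> n))
  ... | yes le with deg q ℕ.≤? e
  ...   | no n = zero-*ʳ (f p) (G q (ℕₚ.≰⇒> n))
  ...   | yes le′ = contradiction (ℕₚ.+-mono-≤ le le′) (ℕₚ.<⇒≱ (subst (d ℕ.+ e <_) eq lt))

parity-pad : ∀ m → parity (m ∷ʳ (0 , false)) ≡ parity m
parity-pad []      = refl
parity-pad (v ∷ m) = cong (odd v xor_) (parity-pad m)

deg-pad : ∀ m → deg (m ∷ʳ (0 , false)) ≡ deg m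
deg-pad []      = refl
deg-pad (v ∷ m) = cong (degₛ v ℕ.+_) (deg-pad m)

⊛-stable : ∀ {f g} → Stable f → Stable g → Stable (f ⊛ g)
⊛-stable F G []      = cong₂ _*_ (F []) (G [])
⊛-stable {f} {g} F G (v ∷ m) = ∑ₛ-cong v λ u w _ → ⊛-stable
  (λ p → cong₂ (λ b z → [-1]^ (odd w ∧ b) · z) (parity-pad p) (F (u ∷ p))) (λ p → G (w ∷ p)) m

𝟙-stable : Stable 𝟙
𝟙-stable []                   = refl
𝟙-stable ((zero , false) ∷ m) = 𝟙-stable m
𝟙-stable ((zero , true)  ∷ m) = refl
𝟙-stable ((suc _ , _)    ∷ m) = refl

-- The transposition of the k-th and (k+1)-st pair, as an automorphism.  It is
-- only meaningful on monomials written with at least k + 2 slots.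
s : ℕ → Series → Series
s zero    f (a ∷ b ∷ m) = [-1]^ (odd a ∧ odd b) · f (b ∷ a ∷ m)
s zero    f m           = f m
s (suc k) f []          = f []
s (suc k) f (v ∷ m)     = s k (f ⟨ v ⟩) m

s-cong : ∀ k m {f g} → (∀ m′ → length m′ ≡ length m → deg m′ ≡ deg m → f m′ ≡ g m′) → s k f m ≡ s k g m
s-cong zero [] h = h [] refl refl
s-cong zero (a ∷ []) h = h (a ∷ []) refl refl
s-cong zero (a ∷ b ∷ m) h = cong ([-1]^ (odd a ∧ odd b) ·_) (h (b ∷ a ∷ m) refl
  (trans (sym (ℕₚ.+-assoc (degₛ b) (degₛ a) (deg m))) (trans (cong (ℕ._+ deg m) (ℕₚ.+-comm (degₛ b) (degₛ a))) (ℕₚ.+-assoc (degₛ a) (degₛ b) (deg m)))))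
s-cong (suc k) [] h = h [] refl refl
s-cong (suc k) (v ∷ m) h = s-cong k m λ m′ l d → h (v ∷ m′) (cong suc l) (cong (degₛ v ℕ.+_) d)

s-⊕ : ∀ k f g m → s k (f ⊕ g) m ≡ s k f m + s k g m
s-⊕ zero f g [] = refl
s-⊕ zero f g (a ∷ []) = refl
s-⊕ zero f g (a ∷ b ∷ m) = sgn-+ (odd a ∧ odd b) _ _
s-⊕ (suc k) f g [] = refl
s-⊕ (suc k) f g (v ∷ m) = s-⊕ k _ _ m

s-sgn : ∀ k p f m → s k (λ q → [-1]^ p · f q) m ≡ [-1]^ p · s k f m
s-sgn zero p f [] = refl
s-sgn zero p f (a ∷ []) = refl
s-sgn zero p f (a ∷ b ∷ m) = sgn-comm (odd a ∧ odd b) p _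
s-sgn (suc k) p f [] = refl
s-sgn (suc k) p f (v ∷ m) = s-sgn k p (f ⟨ v ⟩) m

s-twist : ∀ k p f m → s k (twist p f) m ≡ twist p (s k f) m
s-twist zero p f [] = refl
s-twist zero p f (a ∷ []) = refl
s-twist zero p f (a ∷ b ∷ m) = trans (sgn-comm (odd a ∧ odd b) (p ∧ parity (b ∷ a ∷ m)) (f (b ∷ a ∷ m)))
  (cong (λ z → [-1]^ (p ∧ z) · [-1]^ (odd a ∧ odd b) · f (b ∷ a ∷ m))
    (trans (sym (xor-assoc (odd b) (odd a) (parity m))) (trans (cong (_xor parity m) (xor-comm (odd b) (odd a))) (xor-assoc (odd a) (odd b) (parity m)))))
s-twist (suc k) p f [] = refl
s-twist (suc k) p f (v ∷ m) = trans (s-cong k m λ q _ _ → twist-head p f v q)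
  (trans (s-sgn k (p ∧ odd v) (twist p (f ⟨ v ⟩)) m)
    (trans (cong ([-1]^ (p ∧ odd v) ·_) (s-twist k p (f ⟨ v ⟩) m)) (sym (twist-head p (s (suc k) f) v m))))

s-⊛ : ∀ k f g m → s k (f ⊛ g) m ≡ (s k f ⊛ s k g) m
s-⊛ zero f g [] = refl
s-⊛ zero f g (a ∷ []) = refl
s-⊛ (suc k) f g [] = refl
s-⊛ (suc k) f g (v ∷ m) = trans
  (∑ₛ-additive (λ h → s k h m) (λ p q → s-⊕ k p q m) _ v)
  (∑ₛ-cong v λ u w _ → trans (s-⊛ k (twist (odd w) (f ⟨ u ⟩)) (g ⟨ w ⟩) m)
    (⊛-congˡ (s k (g ⟨ w ⟩)) (s-twist k (odd w) (f ⟨ u ⟩)) m))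
s-⊛ zero f g (a ∷ b ∷ m) = begin
  [-1]^ (odd a ∧ odd b) · ∑ₛ (λ u′ w′ → ∑ₛ (λ u w → T f g u′ w′ u w) a) b
    ≡⟨ cong ([-1]^ (odd a ∧ odd b) ·_) (∑ₛ-fubini (T f g) b a) ⟩
  [-1]^ (odd a ∧ odd b) · ∑ₛ (λ u w → ∑ₛ (λ u′ w′ → T f g u′ w′ u w) b) a
    ≡⟨ trans (∑ₛ-sgn (odd a ∧ odd b) _ a) (∑ₛ-cong a λ u w _ → ∑ₛ-sgn (odd a ∧ odd b) _ b) ⟩
  ∑ₛ (λ u w → ∑ₛ (λ u′ w′ → [-1]^ (odd a ∧ odd b) · T f g u′ w′ u w) b) a
    ≡⟨ ∑ₛ-cong a (λ u w σ → ∑ₛ-cong b (λ u′ w′ σ′ → step u w σ u′ w′ σ′)) ⟩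
  ∑ₛ (λ u w → ∑ₛ (λ u′ w′ → T (s 0 f) (s 0 g) u w u′ w′) b) a ∎
  where
  open ≡-Reasoning
  T : Series → Series → Slot → Slot → Slot → Slot → ℤ
  T f g u w u′ w′ = (twist (odd w′) (twist (odd w) (f ⟨ u ⟩) ⟨ u′ ⟩) ⊛ g ⟨ w ⟩ ⟨ w′ ⟩) m

  signs : ∀ {a u w b u′ w′} → Split a u w → Split b u′ w′ → ∀ x →
    (odd a ∧ odd b) xor ((odd w ∧ x) xor (odd w′ ∧ (odd u xor x)))
    ≡ ((odd w′ ∧ x) xor ((odd w ∧ (odd u′ xor x)) xor (odd u ∧ odd u′))) xor (odd w ∧ odd w′)
  signs ff ff x = refl
  signs ff tf x = refl
  signs ff ft false = refl
  signs ff ft true = refl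
  signs tf ff x = refl
  signs tf tf x = refl
  signs tf ft false = refl
  signs tf ft true = refl
  signs ft ff false = refl
  signs ft ff true = refl
  signs ft tf false = refl
  signs ft tf true = refl
  signs ft ft false = refl
  signs ft ft true = refl

  step : ∀ u w → Split a u w → ∀ u′ w′ → Split b u′ w′ →
    [-1]^ (odd a ∧ odd b) · T f g u′ w′ u w ≡ T (s 0 f) (s 0 g) u w u′ w′
  step u w σ u′ w′ σ′ = trans (sym (⊛-sgnˡ (odd a ∧ odd b) _ _ m)) (⊛-cong m λ p q _ → pointwise p q)
    where
    pointwise : ∀ p q →
      ([-1]^ (odd a ∧ odd b) · [-1]^ (odd w ∧ parity p) · [-1]^ (odd w′ ∧ (odd u xor parity p)) · f (u′ ∷ u ∷ p)) * g (w′ ∷ w ∷ q)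
      ≡ ([-1]^ (odd w′ ∧ parity p) · [-1]^ (odd w ∧ (odd u′ xor parity p)) · [-1]^ (odd u ∧ odd u′) · f (u′ ∷ u ∷ p)) * ([-1]^ (odd w ∧ odd w′) · g (w′ ∷ w ∷ q))
    pointwise p q = begin
      ([-1]^ A · [-1]^ B · [-1]^ C · F) * G
        ≡⟨ cong (_* G) (trans (cong ([-1]^ A ·_) (sym (sgn-xor B C F))) (sym (sgn-xor A (B xor C) F))) ⟩
      ([-1]^ (A xor (B xor C)) · F) * G
        ≡⟨ cong (λ z → ([-1]^ z · F) * G) (signs σ σ′ (parity p)) ⟩
      ([-1]^ ((D xor (E xor H)) xor K) · F) * G
        ≡⟨ cong (_* G) (trans (cong ([-1]^_· F) (xor-comm (D xor (E xor H)) K)) (sgn-xor K _ F)) ⟩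
      ([-1]^ K · [-1]^ (D xor (E xor H)) · F) * G
        ≡⟨ trans (sym (sgn-*ˡ K M G)) (sgn-*ʳ K M G) ⟩
      ([-1]^ (D xor (E xor H)) · F) * ([-1]^ K · G)
        ≡⟨ cong (_* ([-1]^ K · G)) (trans (sgn-xor D (E xor H) F) (cong ([-1]^ D ·_) (sgn-xor E H F))) ⟩
      ([-1]^ D · [-1]^ E · [-1]^ H · F) * ([-1]^ K · G) ∎
      where
      F = f (u′ ∷ u ∷ p)
      G = g (w′ ∷ w ∷ q)
      A = odd a ∧ odd b
      B = odd w ∧ parity p
      C = odd w′ ∧ (odd u xor parity p)
      D = odd w′ ∧ parity p
      E = odd w ∧ (odd u′ xor parity p)
      H = odd u ∧ odd u′
      K = odd w ∧ odd w′
      M = [-1]^ (D xor (E xor H)) · F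

Adjacent : Series → Set
Adjacent f = ∀ k m → s k f m ≡ f m

⊛-adjacent : ∀ {f g} → Adjacent f → Adjacent g → Adjacent (f ⊛ g)
⊛-adjacent {f} {g} F G k m = trans (s-⊛ k f g m) (⊛-congˡʳ (F k) (G k) m)

s-𝟘 : Adjacent 𝟘
s-𝟘 zero [] = refl
s-𝟘 zero (a ∷ []) = refl
s-𝟘 zero (a ∷ b ∷ m) = sgn-0 (odd a ∧ odd b)
s-𝟘 (suc k) [] = refl
s-𝟘 (suc k) (v ∷ m) = s-𝟘 k m

s-𝟙 : Adjacent 𝟙
s-𝟙 zero [] = refl
s-𝟙 zero (a ∷ []) = refl
s-𝟙 zero ((zero , false) ∷ (zero , false) ∷ m) = refl
s-𝟙 zero ((zero , false) ∷ (zero , true) ∷ m) = refl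
s-𝟙 zero ((zero , false) ∷ (suc _ , _) ∷ m) = refl
s-𝟙 zero ((zero , true) ∷ (zero , false) ∷ m) = refl
s-𝟙 zero ((zero , true) ∷ (zero , true) ∷ m) = refl
s-𝟙 zero ((zero , true) ∷ (suc _ , ε) ∷ m) = sgn-0 ε
s-𝟙 zero ((suc _ , ε) ∷ (zero , false) ∷ m) = sgn-0 (ε ∧ false)
s-𝟙 zero ((suc _ , ε) ∷ (zero , true) ∷ m) = sgn-0 (ε ∧ true)
s-𝟙 zero ((suc _ , ε) ∷ (suc _ , δ) ∷ m) = sgn-0 (ε ∧ δ)
s-𝟙 (suc k) [] = refl
s-𝟙 (suc k) ((zero , false) ∷ m) = s-𝟙 k m
s-𝟙 (suc k) ((zero , true) ∷ m) = s-𝟘 k m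
s-𝟙 (suc k) ((suc _ , _) ∷ m) = s-𝟘 k m

sum-false : ∀ {n} (t : Fin n → Bool) → (∀ i → t i ≡ false) → sum t ≡ false
sum-false {n} t e = trans (sum-cong-≗ e) (sum-replicate-zero n)

adjacentPerm : ℕ → ∀ n → Permutation′ n
adjacentPerm zero    (suc (suc n)) = Perm.swap Perm.id
adjacentPerm zero    n             = Perm.id
adjacentPerm (suc k) zero          = Perm.id
adjacentPerm (suc k) (suc n)       = Perm.lift₀ (adjacentPerm k n)

permute-id : ∀ {n} (m : Vec Slot n) → permute Perm.id m ≡ m
permute-id = tabulate∘lookup

no-inversion-id : ∀ {n} (m : Vec Slot n) i j → inversion Perm.id m i j ≡ false
no-inversion-id m i j = cong (_∧ (odd (lookup m i) ∧ odd (lookup m j))) (asym (toℕ i) (toℕ j))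
  where
  asym : ∀ a b → does (a ℕ.<? b) ∧ does (b ℕ.<? a) ≡ false
  asym zero    zero    = refl
  asym zero    (suc b) = refl
  asym (suc a) zero    = refl
  asym (suc a) (suc b) = asym a b

inversions-id : ∀ {n} (m : Vec Slot n) → inversions Perm.id m ≡ false
inversions-id m = sum-false _ λ i → sum-false _ λ j → no-inversion-id m i j

inversions-lift : ∀ {n} (σ : Permutation′ n) v (m : Vec Slot n) →
  inversions (Perm.lift₀ σ) (v Vec.∷ m) ≡ inversions σ m
inversions-lift σ v m = cong (_xor inversions σ m)
  (sum-false (inversion (Perm.lift₀ σ) (v Vec.∷ m) zero) λ { zero → refl ; (suc j) → refl })

invariant⇒adjacent : ∀ {f} → Invariant f → Adjacent f
invariant⇒adjacent {f} inv k m = subst (λ z → s k f z ≡ f z) (toList∘fromList m) (go k (fromList m) f inv′)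
  where
  inv′ : ∀ (σ : Permutation′ (length m)) (v : Vec Slot (length m)) → _
  inv′ σ v = inv σ v
  go : ∀ k {n} (v : Vec Slot n) (f : Series) →
    (∀ (σ : Permutation′ n) (v : Vec Slot n) → f (toList (permute σ v)) ≡ [-1]^ inversions σ v · f (toList v)) →
    s k f (toList v) ≡ f (toList v)
  go zero Vec.[] f inv = refl
  go zero (a Vec.∷ Vec.[]) f inv = refl
  go zero {suc (suc n)} (a Vec.∷ b Vec.∷ v) f inv = trans
    (cong ([-1]^ (odd a ∧ odd b) ·_) (trans (cong f (cong (λ z → b ∷ a ∷ toList z) (sym (permute-id v)))) (trans (inv (adjacentPerm 0 _) (a Vec.∷ b Vec.∷ v)) (cong ([-1]^_· f (a ∷ b ∷ toList v)) signEq))))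
    (sgn-sgn (odd a ∧ odd b) (f (a ∷ b ∷ toList v)))
    where
    w = a Vec.∷ b Vec.∷ v
    rows : ∀ i → sum (inversion (adjacentPerm 0 _) w (suc i)) ≡ false
    rows i = sum-false (inversion (adjacentPerm 0 _) w (suc i)) (row i)
      where
      row : ∀ i j → inversion (adjacentPerm 0 _) w (suc i) j ≡ false
      row zero    zero          = refl
      row zero    (suc zero)    = refl
      row zero    (suc (suc j)) = refl
      row (suc i) zero          = refl
      row (suc i) (suc zero)    = refl
      row (suc i) (suc (suc j)) = no-inversion-id v i j
    signEq : inversions (adjacentPerm 0 _) w ≡ odd a ∧ odd b
    signEq = begin
      ((odd a ∧ odd b) xor sum (λ j → inversion (adjacentPerm 0 _) w zero (suc (suc j)))) xor sum (λ i → sum (inversion (adjacentPerm 0 _) w (suc i)))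
        ≡⟨ cong₂ (λ y z → ((odd a ∧ odd b) xor y) xor z) (sum-false (λ j → inversion (adjacentPerm 0 _) w zero (suc (suc j))) (λ j → refl)) (sum-false _ rows) ⟩
      ((odd a ∧ odd b) xor false) xor false
        ≡⟨ trans (xor-identityʳ ((odd a ∧ odd b) xor false)) (xor-identityʳ (odd a ∧ odd b)) ⟩
      odd a ∧ odd b ∎
      where open ≡-Reasoning
  go (suc k) Vec.[] f inv = refl
  go (suc k) (a Vec.∷ v) f inv = go k v (f ⟨ a ⟩) λ σ w →
    trans (inv (Perm.lift₀ σ) (a Vec.∷ w)) (cong ([-1]^_· f (a ∷ toList w)) (inversions-lift σ a w))

vec-ext : ∀ {n} {x y : Vec Slot n} → (∀ i → lookup x i ≡ lookup y i) → x ≡ y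
vec-ext {x = x} {y} e = trans (sym (tabulate∘lookup x)) (trans (tabulate-cong e) (tabulate∘lookup y))

Adjacent-tail : ∀ {f} → Adjacent f → ∀ v → Adjacent (f ⟨ v ⟩)
Adjacent-tail adj v k m = adj (suc k) (v ∷ m)

before : ∀ {n} → Fin (suc n) → Vec Slot n → Bool
before k w = sum λ p → does (toℕ p ℕ.<? toℕ k) ∧ odd (lookup w p)

insert-sign : ∀ {n} (f : Series) → Adjacent f → ∀ (w : Vec Slot n) k a →
  f (toList (insertAt w k a)) ≡ [-1]^ (odd a ∧ before k w) · f (a ∷ toList w)
insert-sign {n} f adj w zero a = cong ([-1]^_· f (a ∷ toList w)) (sym (trans (cong (odd a ∧_) (sum-false (λ p → does (toℕ p ℕ.<? 0) ∧ odd (lookup w p)) λ p → refl)) (∧-zeroʳ (odd a))))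
insert-sign f adj (b Vec.∷ w) (suc k) a = begin
  f (b ∷ toList (insertAt w k a))
    ≡⟨ insert-sign (f ⟨ b ⟩) (Adjacent-tail adj b) w k a ⟩
  [-1]^ (odd a ∧ before k w) · f (b ∷ a ∷ toList w)
    ≡⟨ cong ([-1]^ (odd a ∧ before k w) ·_) (sym (adj 0 (b ∷ a ∷ toList w))) ⟩
  [-1]^ (odd a ∧ before k w) · [-1]^ (odd b ∧ odd a) · F
    ≡⟨ sgn-comm (odd a ∧ before k w) (odd b ∧ odd a) F ⟩
  [-1]^ (odd b ∧ odd a) · [-1]^ (odd a ∧ before k w) · F
    ≡⟨ sgn-xor (odd b ∧ odd a) (odd a ∧ before k w) F ⟨
  [-1]^ ((odd b ∧ odd a) xor (odd a ∧ before k w)) · F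
    ≡⟨ cong ([-1]^_· F) (trans (cong (_xor (odd a ∧ before k w)) (∧-comm (odd b) (odd a))) (sym (∧-xor (odd a) (odd b) (before k w)))) ⟩
  [-1]^ (odd a ∧ (odd b xor before k w)) · F ≡⟨⟩
  [-1]^ (odd a ∧ before (suc k) (b Vec.∷ w)) · F ∎
  where
  open ≡-Reasoning
  F = f (a ∷ b ∷ toList w)

punchIn-<ʳ : ∀ {n} (k : Fin (suc n)) (p : Fin n) → does (punchIn k p <? k) ≡ does (toℕ p ℕ.<? toℕ k)
punchIn-<ʳ zero p = refl
punchIn-<ʳ (suc k) zero = refl
punchIn-<ʳ (suc k) (suc p) = punchIn-<ʳ k p

punchIn-<₂ : ∀ {n} (k : Fin (suc n)) (p q : Fin n) → does (punchIn k p <? punchIn k q) ≡ does (p <? q)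
punchIn-<₂ zero p q = refl
punchIn-<₂ (suc k) zero zero = refl
punchIn-<₂ (suc k) zero (suc q) = refl
punchIn-<₂ (suc k) (suc p) zero = refl
punchIn-<₂ (suc k) (suc p) (suc q) = punchIn-<₂ k p q

adjacent⇒invariant : ∀ {f} → Adjacent f → Invariant f
adjacent⇒invariant adj {zero} σ Vec.[] = refl
adjacent⇒invariant {f} adj {suc n} σ (a Vec.∷ m) = begin
  f (toList (permute σ (a Vec.∷ m)))
    ≡⟨ cong (λ z → f (toList z)) insertion ⟩
  f (toList (insertAt (permute ρ m) k a))
    ≡⟨ insert-sign f adj (permute ρ m) k a ⟩
  [-1]^ (odd a ∧ before k (permute ρ m)) · f (a ∷ toList (permute ρ m))
    ≡⟨ cong ([-1]^ (odd a ∧ before k (permute ρ m)) ·_) (adjacent⇒invariant (Adjacent-tail adj a) ρ m) ⟩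
  [-1]^ (odd a ∧ before k (permute ρ m)) · [-1]^ inversions ρ m · F
    ≡⟨ sgn-xor (odd a ∧ before k (permute ρ m)) (inversions ρ m) F ⟨
  [-1]^ ((odd a ∧ before k (permute ρ m)) xor inversions ρ m) · F
    ≡⟨ cong ([-1]^_· F) (cong₂ _xor_ firstRow otherRows) ⟨
  [-1]^ inversions σ (a Vec.∷ m) · F ∎
  where
  open ≡-Reasoning
  F = f (a ∷ toList m)
  k = σ ⟨$⟩ʳ zero
  ρ = Perm.remove zero σ
  at : ∀ j → σ ⟨$⟩ʳ suc j ≡ punchIn k (ρ ⟨$⟩ʳ j)
  at = Perm.punchIn-permute σ zero

  insertion : permute σ (a Vec.∷ m) ≡ insertAt (permute ρ m) k a
  insertion = vec-ext λ i → trans (lookup∘tabulate (λ i → lookup (a Vec.∷ m) (σ ⟨$⟩ˡ i)) i) (trans (sym (look (σ ⟨$⟩ˡ i))) (cong (lookup (insertAt (permute ρ m) k a)) (Perm.inverseʳ σ)))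
    where
    look : ∀ j → lookup (insertAt (permute ρ m) k a) (σ ⟨$⟩ʳ j) ≡ lookup (a Vec.∷ m) j
    look zero    = insertAt-lookup (permute ρ m) k a
    look (suc j) = trans (cong (lookup (insertAt (permute ρ m) k a)) (at j))
      (trans (insertAt-punchIn (permute ρ m) k a (ρ ⟨$⟩ʳ j))
        (trans (lookup∘tabulate _ (ρ ⟨$⟩ʳ j)) (cong (lookup m) (Perm.inverseˡ ρ))))

  sum-∧ : ∀ {n} b (t : Fin n → Bool) → sum (λ i → t i ∧ b) ≡ b ∧ sum t
  sum-∧ false t = sum-false _ λ i → ∧-zeroʳ (t i)
  sum-∧ true  t = sum-cong-≗ λ i → trans (∧-comm (t i) true) refl

  firstRow : sum (inversion σ (a Vec.∷ m) zero) ≡ odd a ∧ before k (permute ρ m)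
  firstRow = begin
    sum (λ j → does (σ ⟨$⟩ʳ suc j <? k) ∧ (odd a ∧ odd (lookup m j)))
      ≡⟨ sum-cong-≗ (λ j → trans (cong₂ _∧_ (trans (cong (λ z → does (z <? k)) (at j)) (punchIn-<ʳ k (ρ ⟨$⟩ʳ j)))
            (cong (λ z → odd a ∧ odd z) (sym (trans (lookup∘tabulate _ (ρ ⟨$⟩ʳ j)) (cong (lookup m) (Perm.inverseˡ ρ))))))
            (rotate (does (toℕ (ρ ⟨$⟩ʳ j) ℕ.<? toℕ k)) (odd a) _)) ⟩
    sum (λ j → entry (ρ ⟨$⟩ʳ j) ∧ odd a)
      ≡⟨ sum-∧ (odd a) (λ j → entry (ρ ⟨$⟩ʳ j)) ⟩
    odd a ∧ sum (λ j → entry (ρ ⟨$⟩ʳ j))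
      ≡⟨ cong (odd a ∧_) (sum-permute entry ρ) ⟨
    odd a ∧ before k (permute ρ m) ∎
    where
    entry : Fin n → Bool
    entry p = does (toℕ p ℕ.<? toℕ k) ∧ odd (lookup (permute ρ m) p)
    rotate : ∀ x y z → x ∧ (y ∧ z) ≡ (x ∧ z) ∧ y
    rotate false y z = refl
    rotate true  y z = ∧-comm y z

  otherRows : sum (λ i → sum (inversion σ (a Vec.∷ m) (suc i))) ≡ inversions ρ m
  otherRows = sum-cong-≗ λ i → sum-cong-≗ λ j →
    cong (λ z → (does (i <? j) ∧ z) ∧ (odd (lookup m i) ∧ odd (lookup m j)))
      (trans (cong₂ (λ y z → does (y <? z)) (at j) (at i)) (punchIn-<₂ k (ρ ⟨$⟩ʳ j) (ρ ⟨$⟩ʳ i)))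

infix 4 _≈[_]_
_≈[_]_ : Series → ℕ → Series → Set
f ≈[ n ] g = ∀ m → length m ≡ n → f m ≡ g m

⊛-cong-≈ : ∀ {n f g f′ g′} → f ≈[ n ] f′ → g ≈[ n ] g′ → f ⊛ g ≈[ n ] f′ ⊛ g′
⊛-cong-≈ F G m refl = ⊛-cong m λ p q σ →
  cong₂ _*_ (F p (proj₁ (splits-length σ))) (G q (proj₂ (splits-length σ)))

-- Classes of series containing every finite expression used to build the
-- generating functions.
record Closed (P : Series → Set) : Set where
  field
    has-𝟙 : P 𝟙
    has-⊕ : ∀ {f g} → P f → P g → P (f ⊕ g)
    has-⊖ : ∀ {f g} → P f → P g → P (f ⊖ g)
    has-⊛ : ∀ {f g} → P f → P g → P (f ⊛ g)

  has-^ : ∀ {f} → P f → ∀ k → P (f ^ k)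
  has-^ pf zero    = has-𝟙
  has-^ pf (suc k) = has-⊛ pf (has-^ pf k)

  has-geo : ∀ {f} → P f → ∀ k → P (geo f k)
  has-geo pf zero    = has-𝟙
  has-geo pf (suc k) = has-⊕ (has-geo pf k) (has-^ pf (suc k))

  has-∏ : ∀ {F} → (∀ i → P (F i)) → ∀ n → P (∏ F n)
  has-∏ pF zero    = has-𝟙
  has-∏ pF (suc n) = has-⊛ (has-∏ pF n) (pF n)

gen-parity : ∀ v j → HasParity (odd v) (gen v j)
gen-parity v zero [] n = refl
gen-parity v zero (u ∷ m) n with u ≟ₛ v
... | no _ = refl
... | yes refl = 𝟙-even m λ e → n (trans (cong (odd v xor_) e) (xor-identityʳ (odd v)))
gen-parity v (suc j) [] n = refl
gen-parity v (suc j) ((zero , false) ∷ m) n = gen-parity v j m n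
gen-parity v (suc j) ((zero , true) ∷ m) n = refl
gen-parity v (suc j) ((suc _ , _) ∷ m) n = refl

⊛-parity : ∀ {p q f g} → HasParity p f → HasParity q g → HasParity (p xor q) (f ⊛ g)
⊛-parity {p} {q} {f} {g} F G m n = ⊛-vanish m λ a b σ → go a b (splits-parity σ)
  where
  go : ∀ a b → parity m ≡ parity a xor parity b → f a * g b ≡ 0ℤ
  go a b e with parity a Bool.≟ p
  ... | no n₁ = zero-*ˡ (g b) (F a n₁)
  ... | yes e₁ with parity b Bool.≟ q
  ...   | no n₂ = zero-*ʳ (f a) (G b n₂)
  ...   | yes e₂ = contradiction (trans e (cong₂ _xor_ e₁ e₂)) n

even-closed : Closed (HasParity false)
even-closed = record
  { has-𝟙 = 𝟙-even
  ; has-⊕ = λ F G m n → cong₂ _+_ (F m n) (G m n)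
  ; has-⊖ = λ F G m n → cong₂ _-_ (F m n) (G m n)
  ; has-⊛ = ⊛-parity
  }

gen-stable : ∀ v j → v ≢ (0 , false) → Stable (gen v j)
gen-stable v zero n [] with (0 , false) ≟ₛ v
... | yes e = contradiction (sym e) n
... | no _  = refl
gen-stable v zero n (u ∷ m) with does (u ≟ₛ v)
... | true  = 𝟙-stable m
... | false = refl
gen-stable v (suc zero) n [] = refl
gen-stable v (suc (suc j)) n [] = refl
gen-stable v (suc j) n ((zero , false) ∷ m) = gen-stable v j n m
gen-stable v (suc j) n ((zero , true) ∷ m) = refl
gen-stable v (suc j) n ((suc _ , _) ∷ m) = refl

stable-closed : Closed Stable
stable-closed = record
  { has-𝟙 = 𝟙-stable
  ; has-⊕ = λ F G m → cong₂ _+_ (F m) (G m)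
  ; has-⊖ = λ F G m → cong₂ _-_ (F m) (G m)
  ; has-⊛ = ⊛-stable
  }

-- With the first pair read as (t , τ): the degree in (t , τ) minus the degree
-- in the remaining variables is a - b.
Balanced : ℕ → ℕ → Series → Set
Balanced a b f = ∀ v m → degₛ v ℕ.+ b ≢ deg m ℕ.+ a → f (v ∷ m) ≡ 0ℤ

𝟙-deg : ∀ m → deg m ≢ 0 → 𝟙 m ≡ 0ℤ
𝟙-deg [] n = contradiction refl n
𝟙-deg ((zero , false) ∷ m) n = 𝟙-deg m n
𝟙-deg ((zero , true) ∷ m) n = refl
𝟙-deg ((suc _ , _) ∷ m) n = refl

gen-deg : ∀ v j m → deg m ≢ degₛ v → gen v j m ≡ 0ℤ
gen-deg v zero [] n = refl
gen-deg v zero (u ∷ m) n with u ≟ₛ v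
... | no _ = refl
... | yes refl = 𝟙-deg m λ e → n (trans (cong (degₛ v ℕ.+_) e) (ℕₚ.+-identityʳ (degₛ v)))
gen-deg v (suc j) [] n = refl
gen-deg v (suc j) ((zero , false) ∷ m) n = gen-deg v j m n
gen-deg v (suc j) ((zero , true) ∷ m) n = refl
gen-deg v (suc j) ((suc _ , _) ∷ m) n = refl

head-balanced : ∀ v → degₛ v ≡ 1 → Balanced 1 0 (gen v 0)
head-balanced v d u m n with u ≟ₛ v
... | no _ = refl
... | yes refl = 𝟙-deg m λ e → n (trans (ℕₚ.+-identityʳ (degₛ v)) (trans d (cong (ℕ._+ 1) (sym e))))

tail-balanced : ∀ v j → degₛ v ≡ 1 → Balanced 0 1 (gen v (suc j))
tail-balanced v j d (zero , false) m n = gen-deg v j m λ e → n (sym (trans (ℕₚ.+-identityʳ (deg m)) (trans e d)))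
tail-balanced v j d (zero , true) m n = refl
tail-balanced v j d (suc _ , _) m n = refl

⊛-balanced : ∀ {a b c d f g} → Balanced a b f → Balanced c d g → Balanced (a ℕ.+ c) (b ℕ.+ d) (f ⊛ g)
⊛-balanced {a} {b} {c} {d} {f} {g} F G v m n = ⊛-vanish (v ∷ m) {f} {g} λ { (u ∷ p) (w ∷ q) (σ ∷ ρ) → go u p w q (split-deg σ) (splits-deg ρ) }
  where
  go : ∀ u p w q → degₛ v ≡ degₛ u ℕ.+ degₛ w → deg m ≡ deg p ℕ.+ deg q → f (u ∷ p) * g (w ∷ q) ≡ 0ℤ
  go u p w q e₁ e₂ with degₛ u ℕ.+ b ℕ.≟ deg p ℕ.+ a
  ... | no n₁ = zero-*ˡ (g (w ∷ q)) (F u p n₁)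
  ... | yes h₁ with degₛ w ℕ.+ d ℕ.≟ deg q ℕ.+ c
  ...   | no n₂ = zero-*ʳ (f (u ∷ p)) (G w q n₂)
  ...   | yes h₂ = contradiction (trans (cong (ℕ._+ (b ℕ.+ d)) e₁) (trans (+-interchange (degₛ u) (degₛ w) b d)
            (trans (cong₂ ℕ._+_ h₁ h₂) (trans (+-interchange (deg p) a (deg q) c) (cong (ℕ._+ (a ℕ.+ c)) (sym e₂)))))) n

balanced-closed : Closed (Balanced 0 0)
balanced-closed = record
  { has-𝟙 = λ v m n → 𝟙-deg (v ∷ m) λ e → n (trans (cong (ℕ._+ 0) (ℕₚ.m+n≡0⇒m≡0 (degₛ v) e)) (cong (ℕ._+ 0) (sym (ℕₚ.m+n≡0⇒n≡0 (degₛ v) e))))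
  ; has-⊕ = λ F G v m n → cong₂ _+_ (F v m n) (G v m n)
  ; has-⊖ = λ F G v m n → cong₂ _-_ (F v m n) (G v m n)
  ; has-⊛ = λ {f} {g} F G v m n → ⊛-balanced {f = f} {g} F G v m n
  }

balanced-pair : ∀ v j → degₛ v ≡ 1 → Balanced 0 0 (gen v 0 ⊛ gen v (suc j))
balanced-pair v j d u m n = ⊛-balanced {f = gen v 0} {g = gen v (suc j)} (head-balanced v d) (tail-balanced v j d) u m
  λ e → n (trans (ℕₚ.+-identityʳ (degₛ u)) (trans (ℕₚ.+-cancelʳ-≡ 1 (degₛ u) (deg m) e) (sym (ℕₚ.+-identityʳ (deg m)))))

swapIndex : ℕ → ℕ → ℕ
swapIndex zero    zero          = 1
swapIndex zero    (suc zero)    = 0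
swapIndex zero    (suc (suc j)) = suc (suc j)
swapIndex (suc k) zero          = zero
swapIndex (suc k) (suc j)       = suc (swapIndex k j)

if-sgn : ∀ b p z → [-1]^ p · (if b then z else 0ℤ) ≡ (if b then [-1]^ p · z else 0ℤ)
if-sgn true  p z = refl
if-sgn false p z = sgn-0 p

if-0 : ∀ b → (if b then 0ℤ else 0ℤ) ≡ 0ℤ
if-0 true  = refl
if-0 false = refl

gen-head : ∀ v j u m → u ≢ (0 , false) → gen v (suc j) (u ∷ m) ≡ 0ℤ
gen-head v j (zero , false) m n = contradiction refl n
gen-head v j (zero , true)  m n = refl
gen-head v j (suc _ , _)    m n = refl

s-gen : ∀ v k j m → suc k < length m → s k (gen v j) m ≡ gen v (swapIndex k j) m
s-gen v zero j [] ()
s-gen v zero j (a ∷ []) (s≤s ())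
s-gen v zero zero (a ∷ b ∷ m) _ with a ≟ₛ (0 , false)
... | yes refl = refl
... | no n = trans (cong (λ z → [-1]^ (odd a ∧ odd b) · (if does (b ≟ₛ v) then z else 0ℤ)) (𝟙-head a m n))
  (trans (cong ([-1]^ (odd a ∧ odd b) ·_) (if-0 (does (b ≟ₛ v)))) (trans (sgn-0 (odd a ∧ odd b)) (sym (gen-head v 0 a (b ∷ m) n))))
s-gen v zero (suc zero) (a ∷ b ∷ m) _ with b ≟ₛ (0 , false)
... | yes refl = cong ([-1]^_· gen v 0 (a ∷ m)) (∧-zeroʳ (odd a))
... | no n = trans (cong ([-1]^ (odd a ∧ odd b) ·_) (gen-head v 0 b (a ∷ m) n)) (trans (sgn-0 (odd a ∧ odd b))
  (sym (trans (cong (λ z → if does (a ≟ₛ v) then z else 0ℤ) (𝟙-head b m n)) (if-0 (does (a ≟ₛ v))))))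
s-gen v zero (suc (suc j)) (a ∷ b ∷ m) _ with a ≟ₛ (0 , false) | b ≟ₛ (0 , false)
... | yes refl | yes refl = refl
... | yes refl | no n = trans (gen-head v (suc j) b ((0 , false) ∷ m) n) (sym (gen-head v j b m n))
... | no n | yes refl = trans (cong₂ [-1]^_·_ (∧-zeroʳ (odd a)) (gen-head v j a m n)) (sym (gen-head v (suc j) a ((0 , false) ∷ m) n))
... | no n | no n′ = trans (cong ([-1]^ (odd a ∧ odd b) ·_) (gen-head v (suc j) b (a ∷ m) n′)) (trans (sgn-0 (odd a ∧ odd b)) (sym (gen-head v (suc j) a (b ∷ m) n)))
s-gen v (suc k) zero (u ∷ m) l with does (u ≟ₛ v)
... | true  = s-𝟙 k m
... | false = s-𝟘 k m
s-gen v (suc k) (suc j) ((zero , false) ∷ m) (s≤s l) = s-gen v k j m l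
s-gen v (suc k) (suc j) ((zero , true) ∷ m)  (s≤s l) = s-𝟘 k m
s-gen v (suc k) (suc j) ((suc _ , _) ∷ m)    (s≤s l) = s-𝟘 k m

s-⊖ : ∀ k f g m → s k (f ⊖ g) m ≡ s k f m - s k g m
s-⊖ k f g m = trans (s-⊕ k f (⊖ g) m) (cong (s k f m +_) (s-sgn k true g m))

infix 4 _↦[_,_]_
_↦[_,_]_ : Series → ℕ → ℕ → Series → Set
f ↦[ k , n ] g = s k f ≈[ n ] g

module _ {k n : ℕ} where
  ↦-𝟙 : 𝟙 ↦[ k , n ] 𝟙
  ↦-𝟙 m _ = s-𝟙 k m

  ↦-⊕ : ∀ {f g f′ g′} → f ↦[ k , n ] f′ → g ↦[ k , n ] g′ → f ⊕ g ↦[ k , n ] f′ ⊕ g′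
  ↦-⊕ {f} {g} F G m l = trans (s-⊕ k f g m) (cong₂ _+_ (F m l) (G m l))

  ↦-⊖ : ∀ {f g f′ g′} → f ↦[ k , n ] f′ → g ↦[ k , n ] g′ → f ⊖ g ↦[ k , n ] f′ ⊖ g′
  ↦-⊖ {f} {g} F G m l = trans (s-⊖ k f g m) (cong₂ _-_ (F m l) (G m l))

  ↦-⊛ : ∀ {f g f′ g′} → f ↦[ k , n ] f′ → g ↦[ k , n ] g′ → f ⊛ g ↦[ k , n ] f′ ⊛ g′
  ↦-⊛ {f} {g} F G m l = trans (s-⊛ k f g m) (⊛-cong-≈ F G m l)

  ↦-^ : ∀ {f f′} → f ↦[ k , n ] f′ → ∀ j → f ^ j ↦[ k , n ] f′ ^ j
  ↦-^ F zero    = ↦-𝟙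
  ↦-^ F (suc j) = ↦-⊛ F (↦-^ F j)

  ↦-geo : ∀ {f f′} → f ↦[ k , n ] f′ → ∀ j → geo f j ↦[ k , n ] geo f′ j
  ↦-geo F zero    = ↦-𝟙
  ↦-geo F (suc j) = ↦-⊕ (↦-geo F j) (↦-^ F (suc j))

  ↦-recip : ∀ {f f′} → f ↦[ k , n ] f′ → recip f ↦[ k , n ] recip f′
  ↦-recip {f} F m l = trans (s-cong k m λ m′ _ d → cong (λ z → geo (𝟙 ⊖ f) z m′) d) (↦-geo (↦-⊖ ↦-𝟙 F) (deg m) m l)

  ↦-∏ : ∀ {F F′} → (∀ i → F i ↦[ k , n ] F′ i) → ∀ j → ∏ F j ↦[ k , n ] ∏ F′ j
  ↦-∏ E zero    = ↦-𝟙
  ↦-∏ E (suc j) = ↦-⊛ (↦-∏ E j) (E j)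

record Factors (F : ℕ → Series) : Set where
  field
    even     : ∀ i → HasParity false (F i)
    stable   : ∀ i → Stable (F i)
    balanced : ∀ i → Balanced 0 0 (F i)
    moved    : ∀ k n i → 2 ℕ.+ k < n → F i ↦[ suc k , n ] F (swapIndex k i)
    trivial  : ∀ i n → n ≤ i → F i ≈[ n ] 𝟙

σ-< : ∀ k i → i < k → swapIndex k i ≡ i
σ-< (suc k) zero    l       = refl
σ-< (suc k) (suc i) (s≤s l) = cong suc (σ-< k i l)

σ-≡ : ∀ k → swapIndex k k ≡ suc k
σ-≡ zero    = refl
σ-≡ (suc k) = cong suc (σ-≡ k)

σ-suc : ∀ k → swapIndex k (suc k) ≡ k
σ-suc zero    = refl
σ-suc (suc k) = cong suc (σ-suc k)

σ-> : ∀ k i → suc k < i → swapIndex k i ≡ i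
σ-> zero    (suc (suc i)) l = refl
σ-> zero    (suc zero) (s≤s ())
σ-> (suc k) (suc i) (s≤s l) = cong suc (σ-> k i l)

module FactorProperties {F : ℕ → Series} (fac : Factors F) where
  open Factors fac

  ∏-prefix : ∀ k n → n ≤ k → ∏ (F ∘ swapIndex k) n ≗ ∏ F n
  ∏-prefix k zero    l m = refl
  ∏-prefix k (suc n) l m = ⊛-congˡʳ (∏-prefix k n (ℕₚ.<⇒≤ l)) (λ q → cong (λ z → F z q) (σ-< k n l)) m

  ∏-swap : ∀ k n → 2 ℕ.+ k ≤ n → ∏ (F ∘ swapIndex k) n ≗ ∏ F n
  ∏-swap k (suc n) (s≤s l) m with ℕₚ.m≤n⇒m<n∨m≡n l
  ... | inj₁ l′ = ⊛-congˡʳ (∏-swap k n l′) (λ q → cong (λ z → F z q) (σ-> k n l′)) m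
  ... | inj₂ refl = begin
    (∏ (F ∘ swapIndex k) k ⊛ F (swapIndex k k) ⊛ F (swapIndex k (suc k))) m
      ≡⟨ ⊛-congˡʳ (⊛-congˡʳ (∏-prefix k k ℕₚ.≤-refl) (λ q → cong (λ z → F z q) (σ-≡ k))) (λ q → cong (λ z → F z q) (σ-suc k)) m ⟩
    (∏ F k ⊛ F (suc k) ⊛ F k) m
      ≡⟨ ⊛-assoc (∏ F k) (F (suc k)) (F k) m ⟩
    (∏ F k ⊛ (F (suc k) ⊛ F k)) m
      ≡⟨ ⊛-congʳ (∏ F k) (⊛-comm-even (F (suc k)) (F k) (even (suc k))) m ⟩
    (∏ F k ⊛ (F k ⊛ F (suc k))) m
      ≡⟨ ⊛-assoc (∏ F k) (F k) (F (suc k)) m ⟨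
    (∏ F k ⊛ F k ⊛ F (suc k)) m ∎
    where open ≡-Reasoning

  s-short : ∀ k f m → length m ≤ suc k → s k f m ≡ f m
  s-short zero f [] l = refl
  s-short zero f (a ∷ []) l = refl
  s-short zero f (a ∷ b ∷ m) (s≤s ())
  s-short (suc k) f [] l = refl
  s-short (suc k) f (v ∷ m) (s≤s l) = s-short k (f ⟨ v ⟩) m l

  ∏∞-moved : ∀ k m → s (suc k) (∏∞ F) m ≡ ∏∞ F m
  ∏∞-moved k m with length m ℕ.≤? 2 ℕ.+ k
  ... | yes l = s-short (suc k) (∏∞ F) m l
  ... | no ¬l = trans (s-cong (suc k) m λ m′ l _ → cong (λ z → ∏ F z m′) l)
    (trans (↦-∏ {suc k} {length m} {F} {F ∘ swapIndex k} (λ i → moved k (length m) i (ℕₚ.≰⇒> ¬l)) (length m) m refl)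
      (∏-swap k (length m) (ℕₚ.<⇒≤ (ℕₚ.≰⇒> ¬l)) m))

  ∏-limit : ∀ m n → length m ≤ n → ∏ F n m ≡ ∏∞ F m
  ∏-limit m n l with ℕₚ.m≤n⇒m<n∨m≡n l
  ... | inj₂ refl = refl
  ∏-limit m (suc n) l | inj₁ (s≤s l′) = begin
    (∏ F n ⊛ F n) m ≡⟨ ⊛-cong-≈ {f = ∏ F n} (λ _ _ → refl) (trivial n (length m) l′) m refl ⟩
    (∏ F n ⊛ 𝟙) m   ≡⟨ ⊛-identityʳ (∏ F n) m ⟩
    ∏ F n m         ≡⟨ ∏-limit m n l′ ⟩
    ∏∞ F m          ∎
    where open ≡-Reasoning

  ∏∞-stable : Stable (∏∞ F)
  ∏∞-stable m = trans (Closed.has-∏ stable-closed stable (length (m ∷ʳ (0 , false))) m)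
    (∏-limit m _ (pad m))
    where
    pad : ∀ m → length m ≤ length (m ∷ʳ (0 , false))
    pad []      = z≤n
    pad (v ∷ m) = s≤s (pad m)

  ∏∞-balanced : Balanced 0 0 (∏∞ F)
  ∏∞-balanced v m n = Closed.has-∏ balanced-closed balanced (length (v ∷ m)) v m n

gen-short : ∀ v j m → length m ≤ j → gen v j m ≡ 0ℤ
gen-short v zero    [] l = refl
gen-short v (suc j) [] l = refl
gen-short v (suc j) ((zero , false) ∷ m) (s≤s l) = gen-short v j m l
gen-short v (suc j) ((zero , true) ∷ m) (s≤s l) = refl
gen-short v (suc j) ((suc _ , _) ∷ m) (s≤s l) = refl

⊛gen-short : ∀ f v j m → length m ≤ j → (f ⊛ gen v j) m ≡ 0ℤ
⊛gen-short f v j m l = ⊛-vanish m λ p q ρ → zero-*ʳ (f p) (gen-short v j q (subst (_≤ j) (sym (proj₂ (splits-length ρ))) l))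

module _ {P : Series → Set} (cl : Closed P) (pt : ∀ i → P (t ⊛ x i)) (pτ : ∀ i → P (τ ⊛ θ i)) where
  open Closed cl
  closed-E : ∀ i → P (𝟙 ⊕ t ⊛ x i ⊕ τ ⊛ θ i)
  closed-E i = has-⊕ (has-⊕ has-𝟙 (pt i)) (pτ i)

  closed-1-H : ∀ i k → P (geo (𝟙 ⊖ (𝟙 ⊖ t ⊛ x i ⊖ τ ⊛ θ i)) k)
  closed-1-H i k = has-geo (has-⊖ has-𝟙 (has-⊖ (has-⊖ has-𝟙 (pt i)) (pτ i))) k

tx-even : ∀ i → HasParity false (t ⊛ x i)
tx-even i = ⊛-parity {f = t} {g = x i} (gen-parity (1 , false) 0) (gen-parity (1 , false) (suc i))

τθ-even : ∀ i → HasParity false (τ ⊛ θ i)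
τθ-even i = ⊛-parity {f = τ} {g = θ i} (gen-parity (0 , true) 0) (gen-parity (0 , true) (suc i))

tx-stable : ∀ i → Stable (t ⊛ x i)
tx-stable i = ⊛-stable {t} {x i} (gen-stable (1 , false) 0 λ ()) (gen-stable (1 , false) (suc i) λ ())

τθ-stable : ∀ i → Stable (τ ⊛ θ i)
τθ-stable i = ⊛-stable {τ} {θ i} (gen-stable (0 , true) 0 λ ()) (gen-stable (0 , true) (suc i) λ ())

s-pair : ∀ v k n i → 2 ℕ.+ k < n → gen v 0 ⊛ gen v (suc i) ↦[ suc k , n ] gen v 0 ⊛ gen v (suc (swapIndex k i))
s-pair v k n i l = ↦-⊛ {suc k} {n} {gen v 0} {gen v (suc i)}
  (λ m e → s-gen v (suc k) 0 m (subst (_ <_) (sym e) l))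
  (λ m e → s-gen v (suc k) (suc i) m (subst (_ <_) (sym e) l))

factorsE : Factors factorE
factorsE = record
  { even     = closed-E even-closed tx-even τθ-even
  ; stable   = closed-E stable-closed tx-stable τθ-stable
  ; balanced = closed-E balanced-closed (λ i → balanced-pair (1 , false) i refl) (λ i → balanced-pair (0 , true) i refl)
  ; moved    = λ k n i l → ↦-⊕ {suc k} {n} (↦-⊕ {suc k} {n} (↦-𝟙 {suc k} {n}) (s-pair (1 , false) k n i l)) (s-pair (0 , true) k n i l)
  ; trivial  = λ { i n l m refl → trans
      (cong₂ (λ y z → (𝟙 m + y) + z) (⊛gen-short t (1 , false) (suc i) m (ℕₚ.m≤n⇒m≤1+n l)) (⊛gen-short τ (0 , true) (suc i) m (ℕₚ.m≤n⇒m≤1+n l)))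
      (trans (+-identityʳ (𝟙 m + 0ℤ)) (+-identityʳ (𝟙 m))) }
  }

^-short : ∀ u m → (∀ p → length p ≡ length m → u p ≡ 0ℤ) → ∀ k → (u ^ suc k) m ≡ 0ℤ
^-short u m z k = ⊛-vanish m λ p q ρ → zero-*ˡ ((u ^ k) q) (z p (proj₁ (splits-length ρ)))

geo-short : ∀ u m → (∀ p → length p ≡ length m → u p ≡ 0ℤ) → ∀ k → geo u k m ≡ 𝟙 m
geo-short u m z zero    = refl
geo-short u m z (suc k) = trans (cong₂ _+_ (geo-short u m z k) (^-short u m z k)) (+-identityʳ (𝟙 m))

denominator-short : ∀ i m → length m ≤ i → (𝟙 ⊖ t ⊛ x i ⊖ τ ⊛ θ i) m ≡ 𝟙 m
denominator-short i m l = trans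
  (cong₂ (λ y z → (𝟙 m - y) - z) (⊛gen-short t (1 , false) (suc i) m (ℕₚ.m≤n⇒m≤1+n l)) (⊛gen-short τ (0 , true) (suc i) m (ℕₚ.m≤n⇒m≤1+n l)))
  (trans (+-identityʳ (𝟙 m + 0ℤ)) (+-identityʳ (𝟙 m)))

factorsH : Factors factorH
factorsH = record
  { even     = λ i m → closed-1-H even-closed tx-even τθ-even i (deg m) m
  ; stable   = λ i m → trans (cong (λ d → geo (𝟙 ⊖ (𝟙 ⊖ t ⊛ x i ⊖ τ ⊛ θ i)) d (m ∷ʳ (0 , false))) (deg-pad m))
                 (closed-1-H stable-closed tx-stable τθ-stable i (deg m) m)
  ; balanced = λ i v m → closed-1-H balanced-closed (λ i → balanced-pair (1 , false) i refl) (λ i → balanced-pair (0 , true) i refl) i (deg (v ∷ m)) v m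
  ; moved    = λ k n i l → ↦-recip {suc k} {n} (↦-⊖ {suc k} {n} (↦-⊖ {suc k} {n} (↦-𝟙 {suc k} {n}) (s-pair (1 , false) k n i l)) (s-pair (0 , true) k n i l))
  ; trivial  = λ { i n l m refl → geo-short (𝟙 ⊖ (𝟙 ⊖ t ⊛ x i ⊖ τ ⊛ θ i)) m
      (λ p e → trans (cong (λ z → 𝟙 p - z) (denominator-short i p (subst (_≤ i) (sym e) l))) (+-inverseʳ (𝟙 p))) (deg m) }
  }

recip-inverseʳ : ∀ f → (∀ m → deg m ≡ 0 → f m ≡ 1ℤ) → f ⊛ recip f ≗ 𝟙
recip-inverseʳ f f₀ m = begin
  (f ⊛ recip f) m
    ≡⟨ ⊛-cong m (λ p q ρ → cong (f p *_) (sym (geo-limit q (deg m) (subst (deg q ≤_) (sym (splits-deg ρ)) (ℕₚ.m≤n+m (deg q) (deg p)))))) ⟩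
  (f ⊛ geo u (deg m)) m
    ≡⟨ +-identityʳ _ ⟨
  (f ⊛ geo u (deg m)) m + 0ℤ
    ≡⟨ cong ((f ⊛ geo u (deg m)) m +_) (^-low (suc (deg m)) m ℕₚ.≤-refl) ⟨
  (f ⊛ geo u (deg m)) m + (u ^ suc (deg m)) m
    ≡⟨ telescope (deg m) m ⟩
  𝟙 m ∎
  where
  open ≡-Reasoning
  u = 𝟙 ⊖ f

  𝟙-const : ∀ m → deg m ≡ 0 → 𝟙 m ≡ 1ℤ
  𝟙-const []                   e = refl
  𝟙-const ((zero , false) ∷ m) e = 𝟙-const m e

  ^-low : ∀ k m → deg m < k → (u ^ k) m ≡ 0ℤ
  ^-low (suc k) m (s≤s l) = ⊛-vanish m λ p q ρ → go p q (splits-deg ρ)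
    where
    go : ∀ p q → deg m ≡ deg p ℕ.+ deg q → u p * (u ^ k) q ≡ 0ℤ
    go p q e with deg p in d
    ... | zero  = zero-*ˡ ((u ^ k) q) (cong₂ _-_ (𝟙-const p d) (f₀ p d))
    ... | suc c = zero-*ʳ (u p) (^-low k q (ℕₚ.≤-trans (s≤s (ℕₚ.m≤n+m (deg q) c)) (subst (_≤ k) e l)))

  geo-limit : ∀ m d → deg m ≤ d → geo u d m ≡ recip f m
  geo-limit m d l with ℕₚ.m≤n⇒m<n∨m≡n l
  ... | inj₂ refl = refl
  geo-limit m (suc d) l | inj₁ l′@(s≤s l″) = trans (cong₂ _+_ (geo-limit m d l″) (^-low (suc d) m l′)) (+-identityʳ _)

  f⊕u : f ⊕ u ≗ 𝟙
  f⊕u m = trans (+-comm (f m) (𝟙 m - f m)) (trans (+-assoc (𝟙 m) (- f m) (f m)) (trans (cong (𝟙 m +_) (+-inverseˡ (f m))) (+-identityʳ (𝟙 m))))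

  split : ∀ w m → (f ⊛ w) m + (u ⊛ w) m ≡ w m
  split w m = trans (sym (⊛-distribʳ f u w m)) (trans (⊛-congˡ w f⊕u m) (⊛-identityˡ w m))

  telescope : ∀ d m → (f ⊛ geo u d) m + (u ^ suc d) m ≡ 𝟙 m
  telescope zero    m = split 𝟙 m
  telescope (suc d) m = begin
    (f ⊛ (geo u d ⊕ w)) m + (u ⊛ w) m
      ≡⟨ cong (_+ (u ⊛ w) m) (⊛-distribˡ f (geo u d) w m) ⟩
    ((f ⊛ geo u d) m + (f ⊛ w) m) + (u ⊛ w) m
      ≡⟨ +-assoc ((f ⊛ geo u d) m) ((f ⊛ w) m) ((u ⊛ w) m) ⟩
    (f ⊛ geo u d) m + ((f ⊛ w) m + (u ⊛ w) m)
      ≡⟨ cong ((f ⊛ geo u d) m +_) (split w m) ⟩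
    (f ⊛ geo u d) m + w m
      ≡⟨ telescope d m ⟩
    𝟙 m ∎
    where w = u ^ suc d

-- The ring of symmetric functions in superspace over ℤ.
record 𝒫 : Set where
  field
    coeff     : Series
    stable    : Stable coeff
    bounded   : ∃ λ d → BoundedBy d coeff
    invariant : Invariant coeff

open 𝒫 public

infix 4 _≈_
_≈_ : 𝒫 → 𝒫 → Set
f ≈ g = coeff f ≗ coeff g

_+𝒫_ _*𝒫_ : 𝒫 → 𝒫 → 𝒫
f +𝒫 g = record
  { coeff     = coeff f ⊕ coeff g
  ; stable    = λ m → cong₂ _+_ (stable f m) (stable g m)
  ; bounded   = proj₁ (bounded f) ℕ.⊔ proj₁ (bounded g) , λ m l → cong₂ _+_
      (proj₂ (bounded f) m (ℕₚ.m⊔n<o⇒m<o _ _ l)) (proj₂ (bounded g) m (ℕₚ.m⊔n<o⇒n<o (proj₁ (bounded f)) _ l))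
  ; invariant = λ σ m → trans (cong₂ _+_ (invariant f σ m) (invariant g σ m)) (sym (sgn-+ (inversions σ m) _ _))
  }
f *𝒫 g = record
  { coeff     = coeff f ⊛ coeff g
  ; stable    = ⊛-stable (stable f) (stable g)
  ; bounded   = proj₁ (bounded f) ℕ.+ proj₁ (bounded g) , ⊛-bounded {f = coeff f} {coeff g} (proj₂ (bounded f)) (proj₂ (bounded g))
  ; invariant = adjacent⇒invariant (⊛-adjacent {coeff f} {coeff g} (invariant⇒adjacent (invariant f)) (invariant⇒adjacent (invariant g)))
  }

-𝒫_ : 𝒫 → 𝒫
-𝒫 f = record
  { coeff     = ⊖ coeff f
  ; stable    = λ m → cong -_ (stable f m)
  ; bounded   = proj₁ (bounded f) , λ m l → cong -_ (proj₂ (bounded f) m l)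
  ; invariant = λ σ m → trans (cong -_ (invariant f σ m)) (sgn-comm true (inversions σ m) (coeff f (toList m)))
  }

0𝒫 1𝒫 : 𝒫
0𝒫 = record
  { coeff     = 𝟘
  ; stable    = λ _ → refl
  ; bounded   = 0 , λ _ _ → refl
  ; invariant = λ σ m → sym (sgn-0 (inversions σ m))
  }
1𝒫 = record
  { coeff     = 𝟙
  ; stable    = 𝟙-stable
  ; bounded   = 0 , λ m l → 𝟙-deg m λ e → ℕₚ.<-irrefl (sym e) l
  ; invariant = adjacent⇒invariant s-𝟙
  }

𝒫-ring : Ring 0ℓ 0ℓ
𝒫-ring = record
  { Carrier = 𝒫 ; _≈_ = _≈_ ; _+_ = _+𝒫_ ; _*_ = _*𝒫_ ; -_ = -𝒫_ ; 0# = 0𝒫 ; 1# = 1𝒫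
  ; isRing = record
    { +-isAbelianGroup = record
      { isGroup = record
        { isMonoid = record
          { isSemigroup = record
            { isMagma = record
              { isEquivalence = record
                { refl  = λ _ → refl
                ; sym   = λ p m → sym (p m)
                ; trans = λ p q m → trans (p m) (q m)
                }
              ; ∙-cong = λ p q m → cong₂ _+_ (p m) (q m)
              }
            ; assoc = λ f g h m → +-assoc (coeff f m) (coeff g m) (coeff h m)
            }
          ; identity = (λ f m → +-identityˡ (coeff f m)) , (λ f m → +-identityʳ (coeff f m))
          }
        ; inverse = (λ f m → +-inverseˡ (coeff f m)) , (λ f m → +-inverseʳ (coeff f m))
        ; ⁻¹-cong = λ p m → cong -_ (p m)
        }
      ; comm = λ f g m → +-comm (coeff f m) (coeff g m)
      }
    ; *-cong     = ⊛-congˡʳ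
    ; *-assoc    = λ f g h → ⊛-assoc (coeff f) (coeff g) (coeff h)
    ; *-identity = (λ f → ⊛-identityˡ (coeff f)) , (λ f → ⊛-identityʳ (coeff f))
    ; distrib    = (λ f g h → ⊛-distribˡ (coeff f) (coeff g) (coeff h)) , (λ f g h → ⊛-distribʳ (coeff g) (coeff h) (coeff f))
    }
  }

module _ {F : ℕ → Series} (fac : Factors F) where
  open FactorProperties fac

  -- The coefficient of t^a τ^ε in ∏∞ F, with τ written on the left.
  extract : Slot → 𝒫
  extract v = record
    { coeff     = ∏∞ F ⟨ v ⟩
    ; stable    = λ m → ∏∞-stable (v ∷ m)
    ; bounded   = degₛ v , λ m l → ∏∞-balanced v m λ e → ℕₚ.<-irrefl (ℕₚ.+-cancelʳ-≡ 0 (degₛ v) (deg m) e) l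
    ; invariant = adjacent⇒invariant λ k m → ∏∞-moved k (v ∷ m)
    }

e ẽ h h̃ : ℕ → 𝒫
e n = extract factorsE (n , false)
ẽ n = extract factorsE (n , true)
h n = extract factorsH (n , false)
h̃ n = extract factorsH (n , true)

{-# OPTIONS --safe #-}

-- Let E and H be the two generating functions.  Then E(-t,-τ) H(t,τ) = 1.
-- Applying ω̂ to the coefficients gives H(-t,-τ) ω̂H(t,τ) = 1, while also
-- E(t,τ) H(-t,-τ) = 1, so ω̂H = E.
--
-- It remains to see that the e_n and ẽ_n generate the ring, by Gauss's
-- algorithm.  For the lexicographic order with x₁ > θ₁ > x₂ > θ₂ > …, e_n leads
-- with x₁⋯xₙ and ẽ_n with x₁⋯xₙθₙ₊₁, so that the products of these lead, with
-- coefficient ±1, with the monomials ∏ xᵢ^aᵢ θᵢ^εᵢ such that aᵢ ≥ aᵢ₊₁ + εᵢ₊₁.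
-- The leading monomial of an invariant f has this form: otherwise exchanging
-- the i-th and (i+1)-st pair either increases it or changes the sign of its
-- coefficient.  Hence products of generators can be subtracted from f until
-- nothing is left.

module Submission where

open import Defs
open import Algebra.Bundles using (Ring)
open import Algebra.Morphism.Structures using (module RingMorphisms)
open import Data.Bool using (Bool; true; false; _∧_; _xor_; not)
open import Data.Bool.Properties using (not-distribˡ-xor)
open import Data.Empty using (⊥)
open import Data.Integer as ℤ using (ℤ; -[1+_]; _+_; _*_; -_; _-_; 0ℤ; 1ℤ)
import Data.Integer.Properties as ℤₚ
open import Data.List using ([]; _∷_; _∷ʳ_; _++_; length; replicate)
import Data.List.Properties as Listₚ
open import Data.List.Relation.Unary.All using (All; []; _∷_)
open import Data.Nat as ℕ using (ℕ; zero; suc; _≤_; _<_; s≤s; z≤n)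
import Data.Nat.Properties as ℕₚ
open import Data.Product using (_×_; _,_; proj₁; proj₂; ∃; ∃₂)
open import Data.Sum using (_⊎_; inj₁; inj₂)
open import Data.Unit using (⊤; tt)
open import Function using (_∘_)
open import Relation.Binary using (tri<; tri≈; tri>)
open import Relation.Binary.PropositionalEquality
open import Relation.Nullary using (¬_; yes; no; contradiction)

-- The identity E(-t,-τ) H(t,τ) = 1

denominator : ℕ → Series
denominator i = 𝟙 ⊖ t ⊛ x i ⊖ τ ⊛ θ i

𝟙-const : ∀ m → deg m ≡ 0 → 𝟙 m ≡ 1ℤ
𝟙-const []                   e = refl
𝟙-const ((zero , false) ∷ m) e = 𝟙-const m e

pair-const : ∀ v i m → degₛ v ≡ 1 → deg m ≡ 0 → (gen v 0 ⊛ gen v (suc i)) m ≡ 0ℤ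
pair-const v i m d e = ⊛-vanish m λ p q ρ → zero-*ˡ (gen v (suc i) q)
  (gen-deg v 0 p λ e′ → ℕₚ.0≢1+n (trans (sym (ℕₚ.m+n≡0⇒m≡0 (deg p) (trans (sym (splits-deg ρ)) e))) (trans e′ d)))

denominator-const : ∀ i m → deg m ≡ 0 → denominator i m ≡ 1ℤ
denominator-const i m e
  rewrite 𝟙-const m e | pair-const (1 , false) i m refl e | pair-const (0 , true) i m refl e = refl

denominator-even : ∀ i → HasParity false (denominator i)
denominator-even i = has-⊖ (has-⊖ has-𝟙 (tx-even i)) (τθ-even i)
  where open Closed even-closed

-- The last factor `f` is even, hence commutes with `B` and can be moved next to its inverse `g`.
∏-inverse : ∀ {F G} → (∀ i → HasParity false (F i)) → (∀ i → F i ⊛ G i ≗ 𝟙) → ∀ n → ∏ F n ⊛ ∏ G n ≗ 𝟙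
∏-inverse F-even inv zero m = ⊛-identityˡ 𝟙 m
∏-inverse {F} {G} F-even inv (suc n) m = begin
  (A ⊛ f ⊛ (B ⊛ g)) m   ≡⟨ ⊛-assoc A f (B ⊛ g) m ⟩
  (A ⊛ (f ⊛ (B ⊛ g))) m ≡⟨ ⊛-congʳ A (λ q → sym (⊛-assoc f B g q)) m ⟩
  (A ⊛ (f ⊛ B ⊛ g)) m   ≡⟨ ⊛-congʳ A (⊛-congˡ g (⊛-comm-even f B (F-even n))) m ⟩
  (A ⊛ (B ⊛ f ⊛ g)) m   ≡⟨ ⊛-congʳ A (⊛-assoc B f g) m ⟩
  (A ⊛ (B ⊛ (f ⊛ g))) m ≡⟨ ⊛-congʳ A (⊛-congʳ B (inv n)) m ⟩
  (A ⊛ (B ⊛ 𝟙)) m       ≡⟨ ⊛-congʳ A (⊛-identityʳ B) m ⟩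
  (A ⊛ B) m             ≡⟨ ∏-inverse F-even inv n m ⟩
  𝟙 m                   ∎
  where
  open ≡-Reasoning
  A = ∏ F n
  B = ∏ G n
  f = F n
  g = G n

∏-cong : ∀ {F G} → (∀ i → F i ≗ G i) → ∀ n → ∏ F n ≗ ∏ G n
∏-cong F≗G zero    m = refl
∏-cong F≗G (suc n) m = ⊛-congˡʳ (∏-cong F≗G n) (F≗G n) m

isOdd : ℕ → Bool
isOdd zero    = false
isOdd (suc n) = not (isOdd n)

isOdd-+ : ∀ m n → isOdd (m ℕ.+ n) ≡ isOdd m xor isOdd n
isOdd-+ zero    n = refl
isOdd-+ (suc m) n = trans (cong not (isOdd-+ m n)) (not-distribˡ-xor (isOdd m) (isOdd n))

-- The automorphism t ↦ -t, τ ↦ -τ.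
ν : Series → Series
ν f []      = f []
ν f (v ∷ m) = [-1]^ isOdd (degₛ v) · f (v ∷ m)

ν-cong : ∀ m {f g} → f m ≡ g m → ν f m ≡ ν g m
ν-cong []      e = e
ν-cong (v ∷ m) e = cong ([-1]^ isOdd (degₛ v) ·_) e

ν-involutive : ∀ f → ν (ν f) ≗ f
ν-involutive f []      = refl
ν-involutive f (v ∷ m) = sgn-sgn (isOdd (degₛ v)) (f (v ∷ m))

ν-⊕ : ∀ f g → ν (f ⊕ g) ≗ ν f ⊕ ν g
ν-⊕ f g []      = refl
ν-⊕ f g (v ∷ m) = sgn-+ (isOdd (degₛ v)) (f (v ∷ m)) (g (v ∷ m))

-- Degrees in (t, τ) add over a factorisation of the head slot, so the sign splits between the two
-- factors.
ν-⊛ : ∀ f g → ν (f ⊛ g) ≗ ν f ⊛ ν g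
ν-⊛ f g []      = refl
ν-⊛ f g (v ∷ m) = trans (sym (⊛-sgnˡ (isOdd (degₛ v)) f g (v ∷ m)))
  (⊛-cong (v ∷ m) {λ p → [-1]^ isOdd (degₛ v) · f p} {g} {ν f} {ν g} λ { (u ∷ p) (w ∷ q) (σ ∷ _) → signs u w σ (f (u ∷ p)) (g (w ∷ q)) })
  where
  signs : ∀ u w → Split v u w → ∀ y z →
    ([-1]^ isOdd (degₛ v) · y) * z ≡ ([-1]^ isOdd (degₛ u) · y) * ([-1]^ isOdd (degₛ w) · z)
  signs u w σ y z = begin
    ([-1]^ isOdd (degₛ v) · y) * z
      ≡⟨ cong (λ b → ([-1]^ b · y) * z) (trans (cong isOdd (split-deg σ)) (isOdd-+ (degₛ u) (degₛ w))) ⟩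
    ([-1]^ (isOdd (degₛ u) xor isOdd (degₛ w)) · y) * z
      ≡⟨ cong (_* z) (trans (sgn-xor (isOdd (degₛ u)) (isOdd (degₛ w)) y) (sgn-comm (isOdd (degₛ u)) (isOdd (degₛ w)) y)) ⟩
    ([-1]^ isOdd (degₛ w) · [-1]^ isOdd (degₛ u) · y) * z
      ≡⟨ sgn-*ˡ (isOdd (degₛ w)) ([-1]^ isOdd (degₛ u) · y) z ⟨
    [-1]^ isOdd (degₛ w) · (([-1]^ isOdd (degₛ u) · y) * z)
      ≡⟨ sgn-*ʳ (isOdd (degₛ w)) ([-1]^ isOdd (degₛ u) · y) z ⟩
    ([-1]^ isOdd (degₛ u) · y) * ([-1]^ isOdd (degₛ w) · z) ∎
    where open ≡-Reasoning

ν-𝟙 : ν 𝟙 ≗ 𝟙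
ν-𝟙 []                   = refl
ν-𝟙 ((zero , false) ∷ m) = refl
ν-𝟙 ((zero , true) ∷ m)  = refl
ν-𝟙 ((suc a , ε) ∷ m)    = sgn-0 (isOdd (degₛ (suc a , ε)))

ν-∏ : ∀ F n → ν (∏ F n) ≗ ∏ (ν ∘ F) n
ν-∏ F zero    m = ν-𝟙 m
ν-∏ F (suc n) m = trans (ν-⊛ (∏ F n) (F n) m) (⊛-congˡ (ν (F n)) (ν-∏ F n) m)

ν-parameter : ∀ v → degₛ v ≡ 1 → ν (gen v 0) ≗ ⊖ gen v 0
ν-parameter v d []      = refl
ν-parameter v d (u ∷ m) with u ≟ₛ v
... | yes refl = cong (λ n → [-1]^ isOdd n · 𝟙 m) d
... | no  _    = sgn-0 (isOdd (degₛ u))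

ν-variable : ∀ v j → ν (gen v (suc j)) ≗ gen v (suc j)
ν-variable v j []                   = refl
ν-variable v j ((zero , false) ∷ m) = refl
ν-variable v j ((zero , true) ∷ m)  = refl
ν-variable v j ((suc a , ε) ∷ m)    = sgn-0 (isOdd (degₛ (suc a , ε)))

ν-pair : ∀ v j → degₛ v ≡ 1 → ν (gen v 0 ⊛ gen v (suc j)) ≗ ⊖ (gen v 0 ⊛ gen v (suc j))
ν-pair v j d m = trans (ν-⊛ (gen v 0) (gen v (suc j)) m)
  (trans (⊛-congˡʳ (ν-parameter v d) (ν-variable v j) m) (⊛-sgnˡ true (gen v 0) (gen v (suc j)) m))

ν-factorE : ∀ i → ν (factorE i) ≗ denominator i
ν-factorE i m = trans (ν-⊕ (𝟙 ⊕ t ⊛ x i) (τ ⊛ θ i) m) (cong₂ _+_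
  (trans (ν-⊕ 𝟙 (t ⊛ x i) m) (cong₂ _+_ (ν-𝟙 m) (ν-pair (1 , false) i refl m)))
  (ν-pair (0 , true) i refl m))

E H : Series
E = ∏∞ factorE
H = ∏∞ factorH

-- On monomials of length n both infinite products are by definition products of n factors, and ν
-- turns each factor of E into the denominator of the corresponding factor of H.
νE⊛H : ν E ⊛ H ≗ 𝟙
νE⊛H m = trans
  (⊛-cong-≈ {f = ν E} {g = H} {f′ = ∏ denominator n} {g′ = ∏ factorH n}
    (λ { p e → trans (ν-cong p (cong (λ k → ∏ factorE k p) e)) (trans (ν-∏ factorE n p) (∏-cong ν-factorE n p)) })
    (λ { q e → cong (λ k → ∏ factorH k q) e }) m refl)
  (∏-inverse denominator-even (λ i → recip-inverseʳ (denominator i) (denominator-const i)) n m)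
  where n = length m

E⊛νH : E ⊛ ν H ≗ 𝟙
E⊛νH m = begin
  (E ⊛ ν H) m       ≡⟨ ⊛-congˡ (ν H) (ν-involutive E) m ⟨
  (ν (ν E) ⊛ ν H) m ≡⟨ ν-⊛ (ν E) H m ⟨
  ν (ν E ⊛ H) m     ≡⟨ ν-cong m {ν E ⊛ H} {𝟙} (νE⊛H m) ⟩
  ν 𝟙 m             ≡⟨ ν-𝟙 m ⟩
  𝟙 m               ∎
  where open ≡-Reasoning

∏∞-even : ∀ {F} → Factors F → HasParity false (∏∞ F)
∏∞-even fac m = Closed.has-∏ even-closed (Factors.even fac) (length m) m

-- The factor multiplying an odd w is even, so that twist is trivial.
ν-⊛-head : ∀ F G → HasParity false F → ∀ v m →
  (ν F ⊛ G) (v ∷ m) ≡ ∑ₛ (λ u w → [-1]^ isOdd (degₛ u) · (F ⟨ u ⟩ ⊛ G ⟨ w ⟩) m) v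
ν-⊛-head F G F-even v m = ∑ₛ-cong v λ u w σ →
  trans (⊛-congˡ (G ⟨ w ⟩) (untwist σ) m) (⊛-sgnˡ (isOdd (degₛ u)) (F ⟨ u ⟩) (G ⟨ w ⟩) m)
  where
  untwist : ∀ {u w} → Split v u w → ∀ p → twist (odd w) (ν F ⟨ u ⟩) p ≡ [-1]^ isOdd (degₛ u) · F (u ∷ p)
  untwist ff p = refl
  untwist tf p = refl
  untwist (ft {i}) p = twist-even true (ν F ⟨ i , false ⟩)
    (λ q n → trans (cong ([-1]^ isOdd (degₛ (i , false)) ·_) (F-even ((i , false) ∷ q) n)) (sgn-0 (isOdd (degₛ (i , false))))) p

-- Coefficient identities in 𝒫 and their images under ω̂

∑₊𝒫 : (ℕ → ℕ → 𝒫) → ℕ → 𝒫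
∑₊𝒫 T zero    = T 0 0
∑₊𝒫 T (suc a) = T 0 (suc a) +𝒫 ∑₊𝒫 (λ i j → T (suc i) j) a

∑ₑ𝒫 : (Bool → Bool → 𝒫) → Bool → 𝒫
∑ₑ𝒫 T false = T false false
∑ₑ𝒫 T true  = T true false +𝒫 T false true

-- A copy of `∑ₛ` with summands in 𝒫: ω̂ acts on elements of 𝒫, not on their individual integer
-- coefficients.
∑𝒫 : (Slot → Slot → 𝒫) → Slot → 𝒫
∑𝒫 T (a , ε) = ∑₊𝒫 (λ i j → ∑ₑ𝒫 (λ δ η → T (i , δ) (j , η)) ε) a

module _ (φ : 𝒫 → 𝒫) (φ-+ : ∀ f g → φ (f +𝒫 g) ≈ φ f +𝒫 φ g) where
  ∑₊𝒫-additive : ∀ T a m → coeff (φ (∑₊𝒫 T a)) m ≡ ∑₊ (λ i j → coeff (φ (T i j)) m) a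
  ∑₊𝒫-additive T zero    m = refl
  ∑₊𝒫-additive T (suc a) m = trans (φ-+ (T 0 (suc a)) _ m)
    (cong (coeff (φ (T 0 (suc a))) m +_) (∑₊𝒫-additive (λ i j → T (suc i) j) a m))

  ∑𝒫-additive : ∀ T v m → coeff (φ (∑𝒫 T v)) m ≡ ∑ₛ (λ u w → coeff (φ (T u w)) m) v
  ∑𝒫-additive T (a , false) m = ∑₊𝒫-additive _ a m
  ∑𝒫-additive T (a , true)  m = trans (∑₊𝒫-additive _ a m) (∑₊-cong a λ i j _ → φ-+ _ _ m)

[-1]^_·𝒫_ : Bool → 𝒫 → 𝒫
[-1]^ false ·𝒫 f = f
[-1]^ true  ·𝒫 f = -𝒫 f

coeff-[-1]^ : ∀ p f m → coeff ([-1]^ p ·𝒫 f) m ≡ [-1]^ p · coeff f m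
coeff-[-1]^ false f m = refl
coeff-[-1]^ true  f m = refl

const𝒫 : Slot → 𝒫
const𝒫 (zero , false) = 1𝒫
const𝒫 _              = 0𝒫

coeff-const : ∀ v m → coeff (const𝒫 v) m ≡ 𝟙 (v ∷ m)
coeff-const (zero , false) m = refl
coeff-const (zero , true)  m = refl
coeff-const (suc _ , _)    m = refl

-- [t^a τ^ε] E(-t,-τ) H(t,τ) = [t^a τ^ε] 1, as an identity in 𝒫.
e-h-relation : ∀ v → ∑𝒫 (λ u w → [-1]^ isOdd (degₛ u) ·𝒫 (extract factorsE u *𝒫 extract factorsH w)) v ≈ const𝒫 v
e-h-relation v m = begin
  coeff (∑𝒫 _ v) m
    ≡⟨ ∑𝒫-additive (λ f → f) (λ f g m → refl) _ v m ⟩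
  ∑ₛ (λ u w → coeff ([-1]^ isOdd (degₛ u) ·𝒫 (extract factorsE u *𝒫 extract factorsH w)) m) v
    ≡⟨ ∑ₛ-cong v (λ u w _ → coeff-[-1]^ (isOdd (degₛ u)) (extract factorsE u *𝒫 extract factorsH w) m) ⟩
  ∑ₛ (λ u w → [-1]^ isOdd (degₛ u) · (E ⟨ u ⟩ ⊛ H ⟨ w ⟩) m) v
    ≡⟨ ν-⊛-head E H (∏∞-even factorsE) v m ⟨
  (ν E ⊛ H) (v ∷ m)
    ≡⟨ νE⊛H (v ∷ m) ⟩
  𝟙 (v ∷ m)
    ≡⟨ coeff-const v m ⟨
  coeff (const𝒫 v) m ∎
  where open ≡-Reasoning

module _ (ω̂ : 𝒫 → 𝒫) (hom : RingMorphisms.IsRingHomomorphism (Ring.rawRing 𝒫-ring) (Ring.rawRing 𝒫-ring) ω̂)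
         (ω̂-E : ∀ v → ω̂ (extract factorsE v) ≈ extract factorsH v) where
  open RingMorphisms.IsRingHomomorphism hom

  ω̂-[-1]^ : ∀ p f m → coeff (ω̂ ([-1]^ p ·𝒫 f)) m ≡ [-1]^ p · coeff (ω̂ f) m
  ω̂-[-1]^ false f m = refl
  ω̂-[-1]^ true  f m = -‿homo f m

  ω̂-const : ∀ v → ω̂ (const𝒫 v) ≈ const𝒫 v
  ω̂-const (zero , false) = 1#-homo
  ω̂-const (zero , true)  = 0#-homo
  ω̂-const (suc _ , _)    = 0#-homo

  -- The value at [] is irrelevant.
  ω̂H : Series
  ω̂H []      = 1ℤ
  ω̂H (v ∷ m) = coeff (ω̂ (extract factorsH v)) m

  -- This is the image of `e-h-relation` under ω̂, which replaces the coefficients of E by those of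
  -- H, and those of H by those of `ω̂H`.
  νH⊛ω̂H : ∀ v m → (ν H ⊛ ω̂H) (v ∷ m) ≡ 𝟙 (v ∷ m)
  νH⊛ω̂H v m = begin
    (ν H ⊛ ω̂H) (v ∷ m)
      ≡⟨ ν-⊛-head H ω̂H (∏∞-even factorsH) v m ⟩
    ∑ₛ (λ u w → [-1]^ isOdd (degₛ u) · (H ⟨ u ⟩ ⊛ ω̂H ⟨ w ⟩) m) v
      ≡⟨ ∑ₛ-cong v (λ u w _ → trans (ω̂-[-1]^ (isOdd (degₛ u)) (extract factorsE u *𝒫 extract factorsH w) m)
           (cong ([-1]^ isOdd (degₛ u) ·_) (trans (*-homo (extract factorsE u) (extract factorsH w) m) (⊛-congˡ (ω̂H ⟨ w ⟩) (ω̂-E u) m)))) ⟨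
    ∑ₛ (λ u w → coeff (ω̂ ([-1]^ isOdd (degₛ u) ·𝒫 (extract factorsE u *𝒫 extract factorsH w))) m) v
      ≡⟨ ∑𝒫-additive ω̂ +-homo _ v m ⟨
    coeff (ω̂ (∑𝒫 _ v)) m
      ≡⟨ ⟦⟧-cong (e-h-relation v) m ⟩
    coeff (ω̂ (const𝒫 v)) m
      ≡⟨ ω̂-const v m ⟩
    coeff (const𝒫 v) m
      ≡⟨ coeff-const v m ⟩
    𝟙 (v ∷ m) ∎
    where open ≡-Reasoning

  -- Uniqueness of inverses: E is a left inverse and `ω̂H` a right inverse of ν H.
  ω̂-H : ∀ v → ω̂ (extract factorsH v) ≈ extract factorsE v
  ω̂-H v m = begin
    ω̂H (v ∷ m)               ≡⟨ ⊛-identityˡ ω̂H (v ∷ m) ⟨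
    (𝟙 ⊛ ω̂H) (v ∷ m)         ≡⟨ ⊛-congˡ ω̂H E⊛νH (v ∷ m) ⟨
    (E ⊛ ν H ⊛ ω̂H) (v ∷ m)   ≡⟨ ⊛-assoc E (ν H) ω̂H (v ∷ m) ⟩
    -- The identity for ν H ⊛ `ω̂H` is known on nonempty monomials only; this suffices, as factors
    -- are written with as many slots as the product.
    (E ⊛ (ν H ⊛ ω̂H)) (v ∷ m) ≡⟨ ⊛-cong (v ∷ m) {E} {ν H ⊛ ω̂H} {E} {𝟙} (λ { (u ∷ p) (w ∷ q) _ → cong (E (u ∷ p) *_) (νH⊛ω̂H w q) }) ⟩
    (E ⊛ 𝟙) (v ∷ m)          ≡⟨ ⊛-identityʳ E (v ∷ m) ⟩
    E (v ∷ m)                ∎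
    where open ≡-Reasoning

𝐨 𝐱 𝛉 : Slot
𝐨 = 0 , false
𝐱 = 1 , false
𝛉 = 0 , true

-- Recursion for E in the first pair of variables

∏-left : ∀ F n → ∏ F (suc n) ≗ F 0 ⊛ ∏ (F ∘ suc) n
∏-left F zero    m = trans (⊛-identityˡ (F 0) m) (sym (⊛-identityʳ (F 0) m))
∏-left F (suc n) m = trans (⊛-congˡ (F (suc n)) (∏-left F n) m) (⊛-assoc (F 0) (∏ (F ∘ suc) n) (F (suc n)) m)

split-𝐨 : ∀ {u u₁ u₂} → Split u u₁ u₂ → u₁ ≡ 𝐨 → u₂ ≡ u
split-𝐨 ff refl = refl
split-𝐨 ft refl = refl

split-determined : ∀ {v u w w′} → Split v u w → Split v u w′ → w ≡ w′
split-determined σ σ′ = go σ σ′ refl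
  where
  -- Matching two splits of the same slot would require unifying sums of naturals, so the slots are
  -- kept apart and related by an equation.
  go : ∀ {v v′ u w w′} → Split v u w → Split v′ u w′ → v ≡ v′ → w ≡ w′
  go (ff {i}) ff e = cong (_, false) (ℕₚ.+-cancelˡ-≡ i _ _ (cong proj₁ e))
  go (tf {i}) tf e = cong (_, false) (ℕₚ.+-cancelˡ-≡ i _ _ (cong proj₁ e))
  go (ft {i}) ft e = cong (_, true) (ℕₚ.+-cancelˡ-≡ i _ _ (cong proj₁ e))
  go ff ft e with () ← cong proj₂ e
  go ft ff e with () ← cong proj₂ e

-- Independence of the variables x₁, θ₁.
Free₁ : Series → Set
Free₁ f = ∀ v u m → u ≢ 𝐨 → f (v ∷ u ∷ m) ≡ 0ℤ

free₁-closed : Closed Free₁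
free₁-closed = record
  { has-𝟙 = λ { (zero , false) u m n → 𝟙-head u m n ; (zero , true) u m n → refl ; (suc _ , _) u m n → refl }
  ; has-⊕ = λ F G v u m n → cong₂ _+_ (F v u m n) (G v u m n)
  ; has-⊖ = λ F G v u m n → cong₂ _-_ (F v u m n) (G v u m n)
  ; has-⊛ = λ {f} {g} F G v u m n → ⊛-vanish (v ∷ u ∷ m) {f} {g}
      λ { (v₁ ∷ u₁ ∷ p) (v₂ ∷ u₂ ∷ q) (_ ∷ σ ∷ _) → go {f} {g} F G v₁ v₂ p q n σ }
  }
  where
  go : ∀ {f g} → Free₁ f → Free₁ g → ∀ v₁ v₂ p q {u u₁ u₂} → u ≢ 𝐨 → Split u u₁ u₂ →
    f (v₁ ∷ u₁ ∷ p) * g (v₂ ∷ u₂ ∷ q) ≡ 0ℤ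
  go {f} {g} F G v₁ v₂ p q {u} {u₁} {u₂} n σ with u₁ ≟ₛ 𝐨
  ... | no n₁ = zero-*ˡ (g (v₂ ∷ u₂ ∷ q)) (F v₁ u₁ p n₁)
  ... | yes e = zero-*ʳ (f (v₁ ∷ u₁ ∷ p)) (G v₂ u₂ q λ e′ → n (trans (sym (split-𝐨 σ e)) e′))

gen₀-head : ∀ b u m → u ≢ b → gen b 0 (u ∷ m) ≡ 0ℤ
gen₀-head b u m n with u ≟ₛ b
... | yes e = contradiction e n
... | no _  = refl

gen₀-free₁ : ∀ b → Free₁ (gen b 0)
gen₀-free₁ b v u m n with v ≟ₛ b
... | yes _ = 𝟙-head u m n
... | no _  = refl

gen₂-free₁ : ∀ b i → Free₁ (gen b (2 ℕ.+ i))
gen₂-free₁ b i (zero , false) u m n = gen-head b i u m n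
gen₂-free₁ b i (zero , true)  u m n = refl
gen₂-free₁ b i (suc _ , _)    u m n = refl

factorE-free₁ : ∀ i → Free₁ (factorE (suc i))
factorE-free₁ i = has-⊕ {𝟙 ⊕ t ⊛ x (suc i)} {τ ⊛ θ (suc i)} (has-⊕ {𝟙} {t ⊛ x (suc i)} has-𝟙 (pair 𝐱)) (pair 𝛉)
  where
  open Closed free₁-closed
  pair : ∀ b → Free₁ (gen b 0 ⊛ gen b (2 ℕ.+ i))
  pair b = has-⊛ {gen b 0} {gen b (2 ℕ.+ i)} (gen₀-free₁ b) (gen₂-free₁ b i)

restE : ℕ → Series
restE = ∏ (factorE ∘ suc)

restE-free₁ : ∀ n → Free₁ (restE n)
restE-free₁ = Closed.has-∏ free₁-closed factorE-free₁

pair-shift : ∀ b i v m → (gen b 0 ⊛ gen b (2 ℕ.+ i)) (v ∷ 𝐨 ∷ m) ≡ (gen b 0 ⊛ gen b (suc i)) (v ∷ m)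
pair-shift b i v m = ∑ₛ-cong v λ u w _ → ⊛-congʳ _ (shift w) m
  where
  shift : ∀ w q → gen b (2 ℕ.+ i) (w ∷ 𝐨 ∷ q) ≡ gen b (suc i) (w ∷ q)
  shift (zero , false) q = refl
  shift (zero , true)  q = refl
  shift (suc _ , _)    q = refl

𝟙-shift : ∀ v m → 𝟙 (v ∷ 𝐨 ∷ m) ≡ 𝟙 (v ∷ m)
𝟙-shift (zero , false) m = refl
𝟙-shift (zero , true)  m = refl
𝟙-shift (suc _ , _)    m = refl

-- In the absence of x₁ and θ₁, deleting their slot renumbers the remaining variables, which turns
-- `factorE (suc i)` into `factorE i`. The slot `𝐨` has only the trivial factorisation, so it
-- disappears from products by computation.
restE-shift : ∀ n v m → restE n (v ∷ 𝐨 ∷ m) ≡ ∏ factorE n (v ∷ m)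
restE-shift zero    v m = 𝟙-shift v m
restE-shift (suc n) v m = ∑ₛ-cong v λ u w _ →
  ⊛-congˡʳ (twist-cong (odd w) (restE-shift n u))
    (λ q → cong₂ _+_ (cong₂ _+_ (𝟙-shift w q) (pair-shift 𝐱 n w q)) (pair-shift 𝛉 n w q)) m

∑₊-zero : ∀ {T} a → (∀ i j → i ℕ.+ j ≡ a → T i j ≡ 0ℤ) → ∑₊ T a ≡ 0ℤ
∑₊-zero zero    z = z 0 0 refl
∑₊-zero (suc a) z = cong₂ _+_ (z 0 (suc a) refl) (∑₊-zero a λ i j e → z (suc i) j (cong suc e))

∑₊-single : ∀ {T} i j → (∀ i′ j′ → i′ ℕ.+ j′ ≡ i ℕ.+ j → i′ ≢ i → T i′ j′ ≡ 0ℤ) → ∑₊ T (i ℕ.+ j) ≡ T i j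
∑₊-single zero    zero    z = refl
∑₊-single {T} zero (suc j) z = trans (cong (T 0 (suc j) +_) (∑₊-zero j λ i k e → z (suc i) k (cong suc e) λ ())) (ℤₚ.+-identityʳ _)
∑₊-single (suc i) j       z = trans (cong₂ _+_ (z 0 _ refl λ ())
  (∑₊-single i j λ i′ j′ e n → z (suc i′) j′ (cong suc e) (n ∘ ℕₚ.suc-injective))) (ℤₚ.+-identityˡ _)

∑ₛ-single : ∀ {T v u w} → Split v u w → (∀ u′ w′ → Split v u′ w′ → u′ ≢ u → T u′ w′ ≡ 0ℤ) → ∑ₛ T v ≡ T u w
∑ₛ-single (ff {i} {j}) z = ∑₊-single i j λ i′ j′ e n →
  z _ _ (subst (λ a → Split (a , false) (i′ , false) (j′ , false)) e ff) (n ∘ cong proj₁)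
∑ₛ-single {T} (tf {i} {j}) z = trans
  (∑₊-single i j λ i′ j′ e n → cong₂ _+_
    (z _ _ (subst (λ a → Split (a , true) (i′ , true) (j′ , false)) e tf) (n ∘ cong proj₁))
    (z _ _ (subst (λ a → Split (a , true) (i′ , false) (j′ , true)) e ft) (n ∘ cong proj₁)))
  (trans (cong (T (i , true) (j , false) +_) (z _ _ ft λ ())) (ℤₚ.+-identityʳ _))
∑ₛ-single {T} (ft {i} {j}) z = trans
  (∑₊-single i j λ i′ j′ e n → cong₂ _+_
    (z _ _ (subst (λ a → Split (a , true) (i′ , true) (j′ , false)) e tf) (n ∘ cong proj₁))
    (z _ _ (subst (λ a → Split (a , true) (i′ , false) (j′ , true)) e ft) (n ∘ cong proj₁)))
  (trans (cong (_+ T (i , false) (j , true)) (z _ _ tf λ ())) (ℤₚ.+-identityˡ _))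

-- Only the summand with first factor `b` survives; there `gen b 0` restricts to 𝟙, which no twist
-- affects.
gen₀-⊛ : ∀ {v b w} → Split v b w → ∀ g m → (gen b 0 ⊛ g) (v ∷ m) ≡ g (w ∷ m)
gen₀-⊛ {v} {b} {w} σ g m = trans
  (∑ₛ-single {T = λ u w → (twist (odd w) (gen b 0 ⟨ u ⟩) ⊛ g ⟨ w ⟩) m} σ λ u′ w′ _ n → ⊛-vanish m λ p q _ →
    zero-*ˡ (g (w′ ∷ q)) (trans (cong ([-1]^ (odd w′ ∧ parity p) ·_) (gen₀-head b u′ p n)) (sgn-0 (odd w′ ∧ parity p))))
  (trans (⊛-congˡ (g ⟨ w ⟩) (λ p → trans (twist-cong (odd w) at-b p) (twist-even (odd w) 𝟙 𝟙-even p)) m)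
    (⊛-identityˡ (g ⟨ w ⟩) m))
  where
  at-b : gen b 0 ⟨ b ⟩ ≗ 𝟙
  at-b p with b ≟ₛ b
  ... | yes _ = refl
  ... | no n  = contradiction refl n

-- Since `gen b 1` does not involve the parameters, all of `v` comes from `g`. Moving `v` to the
-- left past `b` costs a sign only if both are odd, which is excluded.
gen₁-⊛ : ∀ b v u m g → odd v ∧ odd b ≡ false → (gen b 1 ⊛ g) (v ∷ u ∷ m) ≡ (gen b 0 ⊛ g ⟨ v ⟩) (u ∷ m)
gen₁-⊛ b v u m g e = trans
  (∑ₛ-head _ v λ u′ w′ n → ⊛-vanish (u ∷ m) {twist (odd w′) (gen b 1 ⟨ u′ ⟩)} {g ⟨ w′ ⟩} λ p q _ → zero-*ˡ (g (w′ ∷ q))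
    (trans (cong ([-1]^ (odd w′ ∧ parity p) ·_) (gen-head b 0 u′ p n)) (sgn-0 (odd w′ ∧ parity p))))
  (⊛-congˡ (g ⟨ v ⟩) (untwist (odd v) b e) (u ∷ m))
  where
  untwist : ∀ p b → p ∧ odd b ≡ false → twist p (gen b 0) ≗ gen b 0
  untwist false b           e m = refl
  untwist true  (a , false) e m = twist-even true (gen (a , false) 0) (gen-parity (a , false) 0) m

-- `pair 𝐱` is t x₁ and `pair 𝛉` is τ θ₁.
pair : Slot → Series
pair b = gen b 0 ⊛ gen b 1

-- No sign arises, because the two factors `b` and `w` of a slot are never both odd.
pair-⊛ : ∀ {v b w} → Split v b w → ∀ g m → (pair b ⊛ g) (v ∷ b ∷ m) ≡ g (w ∷ 𝐨 ∷ m)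
pair-⊛ {v} {b} {w} σ g m = trans (⊛-assoc (gen b 0) (gen b 1) g (v ∷ b ∷ m))
  (trans (gen₀-⊛ σ (gen b 1 ⊛ g) (b ∷ m))
    (trans (gen₁-⊛ b w b m g (not-both σ)) (gen₀-⊛ (self b) (g ⟨ w ⟩) m)))
  where
  not-both : ∀ {v b w} → Split v b w → odd w ∧ odd b ≡ false
  not-both ff = refl
  not-both tf = refl
  not-both ft = refl
  self : ∀ b → Split b b 𝐨
  self (a , false) = subst (λ c → Split (c , false) (a , false) 𝐨) (ℕₚ.+-identityʳ a) ff
  self (a , true)  = subst (λ c → Split (c , true) (a , true) 𝐨) (ℕₚ.+-identityʳ a) tf

split-𝐨ʳ : ∀ {u u₁ u₂} → Split u u₁ u₂ → u₂ ≡ 𝐨 → u₁ ≡ u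
split-𝐨ʳ (ff {i}) refl = cong (_, false) (sym (ℕₚ.+-identityʳ i))
split-𝐨ʳ (tf {i}) refl = cong (_, true) (sym (ℕₚ.+-identityʳ i))

pair-vanish₁ : ∀ b v u m → v ≢ b → pair b (v ∷ u ∷ m) ≡ 0ℤ
pair-vanish₁ b v u m n = ⊛-vanish (v ∷ u ∷ m) {gen b 0} {gen b 1} λ { (v₁ ∷ p) (v₂ ∷ q) (σ ∷ _) → go v₁ v₂ p q σ }
  where
  go : ∀ v₁ v₂ p q → Split v v₁ v₂ → gen b 0 (v₁ ∷ p) * gen b 1 (v₂ ∷ q) ≡ 0ℤ
  go v₁ v₂ p q σ with v₂ ≟ₛ 𝐨
  ... | no n₂ = zero-*ʳ (gen b 0 (v₁ ∷ p)) (gen-head b 0 v₂ q n₂)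
  ... | yes e = zero-*ˡ (gen b 1 (v₂ ∷ q)) (gen₀-head b v₁ p λ e₁ → n (trans (sym (split-𝐨ʳ σ e)) e₁))

pair-vanish₂ : ∀ b v u m → u ≢ b → pair b (v ∷ u ∷ m) ≡ 0ℤ
pair-vanish₂ b v u m n = ⊛-vanish (v ∷ u ∷ m) {gen b 0} {gen b 1} λ { (v₁ ∷ u₁ ∷ p) (v₂ ∷ u₂ ∷ q) (_ ∷ σ ∷ _) → go v₁ u₁ p v₂ u₂ q σ }
  where
  gen₁-second : ∀ v₂ u₂ q → u₂ ≢ b → gen b 1 (v₂ ∷ u₂ ∷ q) ≡ 0ℤ
  gen₁-second (zero , false) u₂ q n₂ = gen₀-head b u₂ q n₂
  gen₁-second (zero , true)  u₂ q n₂ = refl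
  gen₁-second (suc _ , _)    u₂ q n₂ = refl
  go : ∀ v₁ u₁ p v₂ u₂ q → Split u u₁ u₂ → gen b 0 (v₁ ∷ u₁ ∷ p) * gen b 1 (v₂ ∷ u₂ ∷ q) ≡ 0ℤ
  go v₁ u₁ p v₂ u₂ q σ with u₁ ≟ₛ 𝐨
  ... | no n₁ = zero-*ˡ (gen b 1 (v₂ ∷ u₂ ∷ q)) (gen₀-free₁ b v₁ u₁ p n₁)
  ... | yes e = zero-*ʳ (gen b 0 (v₁ ∷ u₁ ∷ p)) (gen₁-second v₂ u₂ q λ e₂ → n (trans (sym (split-𝐨 σ e)) e₂))

pair-⊛-vanish₁ : ∀ b v u m g → (∀ w → ¬ Split v b w) → (pair b ⊛ g) (v ∷ u ∷ m) ≡ 0ℤ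
pair-⊛-vanish₁ b v u m g n = ⊛-vanish (v ∷ u ∷ m) {pair b} {g}
  λ { (v₁ ∷ u₁ ∷ p) (v₂ ∷ q) (σ ∷ _) → zero-*ˡ (g (v₂ ∷ q)) (pair-vanish₁ b v₁ u₁ p λ { refl → n v₂ σ }) }

pair-⊛-vanish₂ : ∀ b v u m g → Free₁ g → u ≢ b → (pair b ⊛ g) (v ∷ u ∷ m) ≡ 0ℤ
pair-⊛-vanish₂ b v u m g free n = ⊛-vanish (v ∷ u ∷ m) {pair b} {g}
  λ { (v₁ ∷ u₁ ∷ p) (v₂ ∷ u₂ ∷ q) (_ ∷ σ ∷ _) → go v₁ u₁ p v₂ u₂ q σ }
  where
  go : ∀ v₁ u₁ p v₂ u₂ q → Split u u₁ u₂ → pair b (v₁ ∷ u₁ ∷ p) * g (v₂ ∷ u₂ ∷ q) ≡ 0ℤ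
  go v₁ u₁ p v₂ u₂ q σ with u₂ ≟ₛ 𝐨
  ... | no n₂ = zero-*ʳ (pair b (v₁ ∷ u₁ ∷ p)) (free v₂ u₂ q n₂)
  ... | yes e = zero-*ˡ (g (v₂ ∷ u₂ ∷ q)) (pair-vanish₂ b v₁ u₁ p λ e₁ → n (trans (sym (split-𝐨ʳ σ e)) e₁))

restE-pair : ∀ {v b w} → Split v b w → ∀ n m → (pair b ⊛ restE n) (v ∷ b ∷ m) ≡ ∏ factorE n (w ∷ m)
restE-pair {w = w} σ n m = trans (pair-⊛ σ (restE n) m) (restE-shift n w m)

restE-pair-vanish : ∀ b n v u m → u ≢ b → (pair b ⊛ restE n) (v ∷ u ∷ m) ≡ 0ℤ
restE-pair-vanish b n v u m = pair-⊛-vanish₂ b v u m (restE n) (restE-free₁ n)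

-- The summands 1, t x₁, τ θ₁ of the first factor contribute y₀, y₁, y₂. The monomial has 2 +
-- `length m` slots, so E is a product of that many factors here. The `suc (length m)` left over are
-- exactly those that E needs once the slot of x₁, θ₁ is deleted.
E-peel : ∀ v u m {y₀ y₁ y₂} → let n = suc (length m) in
  restE n (v ∷ u ∷ m) ≡ y₀ → (pair 𝐱 ⊛ restE n) (v ∷ u ∷ m) ≡ y₁ → (pair 𝛉 ⊛ restE n) (v ∷ u ∷ m) ≡ y₂ →
  E (v ∷ u ∷ m) ≡ (y₀ + y₁) + y₂
E-peel v u m {y₀} {y₁} {y₂} e₀ e₁ e₂ = begin
  E w                                           ≡⟨ ∏-left factorE (suc (length m)) w ⟩
  ((𝟙 ⊕ pair 𝐱 ⊕ pair 𝛉) ⊛ g) w                 ≡⟨ ⊛-distribʳ (𝟙 ⊕ pair 𝐱) (pair 𝛉) g w ⟩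
  ((𝟙 ⊕ pair 𝐱) ⊛ g) w + (pair 𝛉 ⊛ g) w         ≡⟨ cong (_+ (pair 𝛉 ⊛ g) w) (⊛-distribʳ 𝟙 (pair 𝐱) g w) ⟩
  ((𝟙 ⊛ g) w + (pair 𝐱 ⊛ g) w) + (pair 𝛉 ⊛ g) w ≡⟨ cong₂ _+_ (cong₂ _+_ (trans (⊛-identityˡ g w) e₀) e₁) e₂ ⟩
  (y₀ + y₁) + y₂                                ∎
  where
  open ≡-Reasoning
  w = v ∷ u ∷ m
  g = restE (suc (length m))

E-𝐨 : ∀ v m → E (v ∷ 𝐨 ∷ m) ≡ E (v ∷ m)
E-𝐨 v m = trans
  (E-peel v 𝐨 m (restE-shift n v m) (restE-pair-vanish 𝐱 n v 𝐨 m λ ()) (restE-pair-vanish 𝛉 n v 𝐨 m λ ()))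
  (trans (ℤₚ.+-identityʳ (E (v ∷ m) + 0ℤ)) (ℤₚ.+-identityʳ (E (v ∷ m))))
  where n = suc (length m)

E-𝐱 : ∀ a ε m → E ((suc a , ε) ∷ 𝐱 ∷ m) ≡ E ((a , ε) ∷ m)
E-𝐱 a ε m = trans
  (E-peel v 𝐱 m (restE-free₁ n v 𝐱 m λ ()) (restE-pair (split ε) n m) (restE-pair-vanish 𝛉 n v 𝐱 m λ ()))
  (trans (ℤₚ.+-identityʳ (0ℤ + E ((a , ε) ∷ m))) (ℤₚ.+-identityˡ (E ((a , ε) ∷ m))))
  where
  n = suc (length m)
  v = suc a , ε
  split : ∀ ε → Split (suc a , ε) 𝐱 (a , ε)
  split false = ff
  split true  = ft

E-𝛉 : ∀ a m → E ((a , true) ∷ 𝛉 ∷ m) ≡ E ((a , false) ∷ m)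
E-𝛉 a m = trans
  (E-peel v 𝛉 m (restE-free₁ n v 𝛉 m λ ()) (restE-pair-vanish 𝐱 n v 𝛉 m λ ()) (restE-pair (tf {0} {a}) n m))
  (ℤₚ.+-identityˡ (E ((a , false) ∷ m)))
  where
  n = suc (length m)
  v = a , true

E-high : ∀ v u m → u ≢ 𝐨 → u ≢ 𝐱 → u ≢ 𝛉 → E (v ∷ u ∷ m) ≡ 0ℤ
E-high v u m n₀ n₁ n₂ = E-peel v u m (restE-free₁ n v u m n₀) (restE-pair-vanish 𝐱 n v u m n₁) (restE-pair-vanish 𝛉 n v u m n₂)
  where n = suc (length m)

-- The term t x₁ cannot occur in the coefficient of τ alone. This excludes the slot `𝐱`, which ranks
-- above `𝛉`, as a head in ẽ₀.
E-τ𝐱 : ∀ m → E (𝛉 ∷ 𝐱 ∷ m) ≡ 0ℤ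
E-τ𝐱 m = E-peel 𝛉 𝐱 m (restE-free₁ n 𝛉 𝐱 m λ ())
  (pair-⊛-vanish₁ 𝐱 𝛉 𝐱 m (restE n) (λ w ())) (restE-pair-vanish 𝛉 n 𝛉 𝐱 m λ ())
  where n = suc (length m)

-- Initial trivial slots are removed by `E-𝐨`; any other slot has positive degree, above the degree
-- bound 0 of e₀.
e₀≈1 : e 0 ≈ 1𝒫
e₀≈1 []      = refl
e₀≈1 (u ∷ m) with u ≟ₛ 𝐨
... | yes refl = trans (E-𝐨 𝐨 m) (e₀≈1 m)
... | no n     = trans (proj₂ (bounded (e 0)) (u ∷ m) (pos u n)) (sym (𝟙-head u m n))
  where
  pos : ∀ u → u ≢ 𝐨 → 0 < deg (u ∷ m)
  pos (zero , false) n = contradiction refl n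
  pos (zero , true)  n = s≤s z≤n
  pos (suc _ , _)    n = s≤s z≤n

-- Leading monomials

-- The position of a slot in 1 < θ < x < xθ < x² < ….
rank : Slot → ℕ
rank v = proj₁ v ℕ.+ degₛ v

unrank : ℕ → Slot
unrank zero          = 𝐨
unrank (suc zero)    = 𝛉
unrank (suc (suc n)) = suc (proj₁ (unrank n)) , proj₂ (unrank n)

rank-suc : ∀ a ε → rank (suc a , ε) ≡ 2 ℕ.+ rank (a , ε)
rank-suc a ε = cong suc (ℕₚ.+-suc a (degₛ (a , ε)))

unrank-rank : ∀ v → unrank (rank v) ≡ v
unrank-rank (zero , false) = refl
unrank-rank (zero , true)  = refl
unrank-rank (suc a , ε)    = trans (cong unrank (rank-suc a ε)) (cong (λ v → suc (proj₁ v) , proj₂ v) (unrank-rank (a , ε)))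

rank-unrank : ∀ n → rank (unrank n) ≡ n
rank-unrank zero          = refl
rank-unrank (suc zero)    = refl
rank-unrank (suc (suc n)) = trans (rank-suc (proj₁ (unrank n)) (proj₂ (unrank n))) (cong (2 ℕ.+_) (rank-unrank n))

rank-injective : ∀ {u v} → rank u ≡ rank v → u ≡ v
rank-injective {u} {v} e = trans (sym (unrank-rank u)) (trans (cong unrank e) (unrank-rank v))

-- The rank of x^a θ^ε is 2a + ε, and both exponents add because at most one factor contains θ.
split-rank : ∀ {v u w} → Split v u w → rank v ≡ rank u ℕ.+ rank w
split-rank {v} {u} {w} σ = trans (cong₂ ℕ._+_ (split-proj₁ σ) (split-deg σ)) (+-interchange (proj₁ u) (proj₁ w) (degₛ u) (degₛ w))
  where
  split-proj₁ : ∀ {v u w} → Split v u w → proj₁ v ≡ proj₁ u ℕ.+ proj₁ w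
  split-proj₁ ff = refl
  split-proj₁ tf = refl
  split-proj₁ ft = refl

infix 4 _≺_
data _≺_ : Mon → Mon → Set where
  here  : ∀ {v u p q} → rank v < rank u → v ∷ p ≺ u ∷ q
  there : ∀ {v p q} → p ≺ q → v ∷ p ≺ v ∷ q

+-<⇒⊎ : ∀ a b c d → a ℕ.+ b < c ℕ.+ d → a < c ⊎ b < d
+-<⇒⊎ a b c d l with c ℕ.≤? a | d ℕ.≤? b
... | no ¬p | _     = inj₁ (ℕₚ.≰⇒> ¬p)
... | yes p | no ¬q = inj₂ (ℕₚ.≰⇒> ¬q)
... | yes p | yes q = contradiction (ℕₚ.+-mono-≤ p q) (ℕₚ.<⇒≱ l)

-- The ranks of the two factors have a fixed sum, so if one falls the other rises.
split-other : ∀ {v u w u′ w′} → Split v u w → Split v u′ w′ → u′ ≢ u → rank u < rank u′ ⊎ rank w < rank w′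
split-other {v} {u} {w} {u′} {w′} σ σ′ n with ℕₚ.<-cmp (rank u) (rank u′)
... | tri< l _ _ = inj₁ l
... | tri≈ _ e _ = contradiction (sym (rank-injective e)) n
... | tri> _ _ l with rank w′ ℕ.≤? rank w
...   | no ¬p = inj₂ (ℕₚ.≰⇒> ¬p)
...   | yes p = contradiction (trans (sym (split-rank σ′)) (split-rank σ)) (ℕₚ.<⇒≢ (ℕₚ.+-mono-<-≤ l p))

-- Compatibility of the order with multiplication. A larger head of r′ forces a larger head of one
-- factor, ranks being additive. With equal heads, either the heads of the factors differ and
-- `split-other` applies, or the tails are compared.
splits-≺ : ∀ {r p q r′ p′ q′} → Splits r p q → Splits r′ p′ q′ → r ≺ r′ → p ≺ p′ ⊎ q ≺ q′
splits-≺ {p = u ∷ _} {w ∷ _} {p′ = u′ ∷ _} {w′ ∷ _} (σ ∷ _) (σ′ ∷ _) (here l)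
  with +-<⇒⊎ (rank u) (rank w) (rank u′) (rank w′) (subst₂ _<_ (split-rank σ) (split-rank σ′) l)
... | inj₁ l₁ = inj₁ (here l₁)
... | inj₂ l₂ = inj₂ (here l₂)
splits-≺ {p = u ∷ _} {w ∷ _} {p′ = u′ ∷ _} {w′ ∷ _} (σ ∷ ρ) (σ′ ∷ ρ′) (there l) with u′ ≟ₛ u
... | no n with split-other σ σ′ n
...   | inj₁ l₁ = inj₁ (here l₁)
...   | inj₂ l₂ = inj₂ (here l₂)
splits-≺ (σ ∷ ρ) (σ′ ∷ ρ′) (there l) | yes refl with split-determined σ σ′ | splits-≺ ρ ρ′ l
... | refl | inj₁ l₁ = inj₁ (there l₁)
... | refl | inj₂ l₂ = inj₂ (there l₂)

VanishesAbove : Mon → Series → Set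
VanishesAbove p f = ∀ m → length m ≡ length p → p ≺ m → f m ≡ 0ℤ

-- The coefficient is ±1; stating this through its square avoids keeping track of the sign.
record Leading (p : Mon) (f : Series) : Set where
  field
    vanishes : VanishesAbove p f
    unit     : f p * f p ≡ 1ℤ

open Leading

leading-cong : ∀ {p f g} → f ≗ g → Leading p f → Leading p g
leading-cong {p} e L = record
  { vanishes = λ m l r → trans (sym (e m)) (vanishes L m l r)
  ; unit     = trans (cong₂ _*_ (sym (e p)) (sym (e p))) (unit L)
  }

leading-∷ : ∀ {v p f} → (∀ u m → rank v < rank u → f (u ∷ m) ≡ 0ℤ) → Leading p (f ⟨ v ⟩) → Leading (v ∷ p) f
leading-∷ z L = record
  { vanishes = λ { (u ∷ m) l (here r) → z u m r ; (_ ∷ m) l (there r) → vanishes L m (ℕₚ.suc-injective l) r }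
  ; unit     = unit L
  }

⊛-vanishesAbove : ∀ {r p q f g} → Splits r p q → VanishesAbove p f → VanishesAbove q g → VanishesAbove r (f ⊛ g)
⊛-vanishesAbove {r} {p} {q} {f} {g} ρ F G m l lt = ⊛-vanish m {f} {g} go
  where
  go : ∀ p′ q′ → Splits m p′ q′ → f p′ * g q′ ≡ 0ℤ
  go p′ q′ ρ′ with splits-≺ ρ ρ′ lt
  ... | inj₁ lt₁ = zero-*ˡ (g q′) (F p′ (trans (proj₁ (splits-length ρ′)) (trans l (sym (proj₁ (splits-length ρ))))) lt₁)
  ... | inj₂ lt₂ = zero-*ʳ (f p′) (G q′ (trans (proj₂ (splits-length ρ′)) (trans l (sym (proj₂ (splits-length ρ))))) lt₂)

-- Every other factorisation of `r` has a factor above `p` or above `q`, so one summand survives.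
-- Its sign comes from the twists and may stay unspecified, since `unit` only involves the square.
⊛-leadingCoeff : ∀ {r p q} f g → Splits r p q → VanishesAbove p f → VanishesAbove q g →
  ∃ λ b → (f ⊛ g) r ≡ [-1]^ b · (f p * g q)
⊛-leadingCoeff f g [] F G = false , refl
⊛-leadingCoeff {v ∷ r} {u ∷ p} {w ∷ q} f g (σ ∷ ρ) F G = b xor c , (begin
  (f ⊛ g) (v ∷ r)
    ≡⟨ ∑ₛ-single {T = λ u w → (twist (odd w) (f ⟨ u ⟩) ⊛ g ⟨ w ⟩) r} σ others ⟩
  (f′ ⊛ g ⟨ w ⟩) r
    ≡⟨ proj₂ IH ⟩
  [-1]^ b · (([-1]^ c · f (u ∷ p)) * g (w ∷ q))
    ≡⟨ cong ([-1]^ b ·_) (sgn-*ˡ c (f (u ∷ p)) (g (w ∷ q))) ⟨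
  [-1]^ b · [-1]^ c · (f (u ∷ p) * g (w ∷ q))
    ≡⟨ sgn-xor b c (f (u ∷ p) * g (w ∷ q)) ⟨
  [-1]^ (b xor c) · (f (u ∷ p) * g (w ∷ q)) ∎)
  where
  open ≡-Reasoning
  f′ = twist (odd w) (f ⟨ u ⟩)
  twist-0 : ∀ a h m → h m ≡ 0ℤ → twist a h m ≡ 0ℤ
  twist-0 a h m e = trans (cong ([-1]^ (a ∧ parity m) ·_) e) (sgn-0 (a ∧ parity m))
  IH = ⊛-leadingCoeff f′ (g ⟨ w ⟩) ρ
    (λ m l lt → twist-0 (odd w) (f ⟨ u ⟩) m (F (u ∷ m) (cong suc l) (there lt)))
    (λ m l lt → G (w ∷ m) (cong suc l) (there lt))
  b = proj₁ IH
  c = odd w ∧ parity p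
  others : ∀ u′ w′ → Split v u′ w′ → u′ ≢ u → (twist (odd w′) (f ⟨ u′ ⟩) ⊛ g ⟨ w′ ⟩) r ≡ 0ℤ
  others u′ w′ σ′ n = ⊛-vanish r {twist (odd w′) (f ⟨ u′ ⟩)} {g ⟨ w′ ⟩} go
    where
    go : ∀ p′ q′ → Splits r p′ q′ → twist (odd w′) (f ⟨ u′ ⟩) p′ * g (w′ ∷ q′) ≡ 0ℤ
    go p′ q′ ρ′ with split-other σ σ′ n
    ... | inj₁ l₁ = zero-*ˡ (g (w′ ∷ q′)) (twist-0 (odd w′) (f ⟨ u′ ⟩) p′
            (F (u′ ∷ p′) (cong suc (trans (proj₁ (splits-length ρ′)) (sym (proj₁ (splits-length ρ))))) (here l₁)))
    ... | inj₂ l₂ = zero-*ʳ (twist (odd w′) (f ⟨ u′ ⟩) p′)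
            (G (w′ ∷ q′) (cong suc (trans (proj₂ (splits-length ρ′)) (sym (proj₂ (splits-length ρ))))) (here l₂))

⊛-leading : ∀ {r p q f g} → Splits r p q → Leading p f → Leading q g → Leading r (f ⊛ g)
⊛-leading {r} {p} {q} {f} {g} ρ F G = record
  { vanishes = ⊛-vanishesAbove {f = f} {g} ρ (vanishes F) (vanishes G)
  ; unit     = begin
      (f ⊛ g) r * (f ⊛ g) r                     ≡⟨ cong (λ z → z * z) (proj₂ c) ⟩
      ([-1]^ b · z) * ([-1]^ b · z)             ≡⟨ sgn-*ˡ b z ([-1]^ b · z) ⟨
      [-1]^ b · (z * ([-1]^ b · z))             ≡⟨ cong ([-1]^ b ·_) (sgn-*ʳ b z z) ⟨
      [-1]^ b · [-1]^ b · (z * z)               ≡⟨ sgn-sgn b (z * z) ⟩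
      z * z                                     ≡⟨ *-interchange (f p) (g q) (f p) (g q) ⟩
      (f p * f p) * (g q * g q)                 ≡⟨ cong₂ _*_ (unit F) (unit G) ⟩
      1ℤ                                        ∎
  }
  where
  open ≡-Reasoning
  open import Algebra.Properties.CommutativeSemigroup ℤₚ.*-commutativeSemigroup using () renaming (interchange to *-interchange)
  c = ⊛-leadingCoeff f g ρ (vanishes F) (vanishes G)
  b = proj₁ c
  z = f p * g q

𝐨s : ℕ → Mon
𝐨s k = replicate k 𝐨

𝐨s-≺⇒deg>0 : ∀ k m → 𝐨s k ≺ m → 0 < deg m
𝐨s-≺⇒deg>0 (suc k) ((zero , true) ∷ m) (here _)  = s≤s z≤n
𝐨s-≺⇒deg>0 (suc k) ((suc _ , _) ∷ m)   (here _)  = s≤s z≤n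
𝐨s-≺⇒deg>0 (suc k) (_ ∷ m)             (there l) = 𝐨s-≺⇒deg>0 k m l

𝟙-leading : ∀ k → Leading (𝐨s k) 𝟙
𝟙-leading k = record
  { vanishes = λ m _ l → 𝟙-deg m λ e → ℕₚ.<-irrefl (sym e) (𝐨s-≺⇒deg>0 k m l)
  ; unit     = cong₂ _*_ (one k) (one k)
  }
  where
  one : ∀ k → 𝟙 (𝐨s k) ≡ 1ℤ
  one zero    = refl
  one (suc k) = one k

E-above-𝐱 : ∀ v u m → rank 𝐱 < rank u → E (v ∷ u ∷ m) ≡ 0ℤ
E-above-𝐱 v u m l = E-high v u m (λ { refl → contradiction l λ () }) (λ { refl → ℕₚ.<-irrefl refl l }) (λ { refl → contradiction l λ { (s≤s ()) } })

-- No exponent of the first pair exceeds that of x₁, and the terms beginning with x₁ are x₁ times e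
-- of index one less in the remaining variables.
e-leading : ∀ n k → Leading (replicate n 𝐱 ++ 𝐨s k) (coeff (e n))
e-leading zero    k = leading-cong (λ m → sym (e₀≈1 m)) (𝟙-leading k)
e-leading (suc n) k = leading-∷ (λ u m → E-above-𝐱 (suc n , false) u m)
  (leading-cong (λ m → sym (E-𝐱 n false m)) (e-leading n k))

ẽ-leading : ∀ n k → Leading (replicate n 𝐱 ++ 𝛉 ∷ 𝐨s k) (coeff (ẽ n))
ẽ-leading zero    k = leading-∷ above (leading-cong (λ m → sym (E-𝛉 0 m)) (e-leading 0 k))
  where
  above : ∀ u m → rank 𝛉 < rank u → coeff (ẽ 0) (u ∷ m) ≡ 0ℤ
  above u m l with ℕₚ.m≤n⇒m<n∨m≡n l
  ... | inj₁ l′ = E-above-𝐱 𝛉 u m l′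
  ... | inj₂ e with rank-injective {𝐱} {u} e
  ...   | refl = E-τ𝐱 m
ẽ-leading (suc n) k = leading-∷ (λ u m → E-above-𝐱 (suc n , true) u m)
  (leading-cong (λ m → sym (E-𝐱 n true m)) (ẽ-leading n k))

-- Generation by the e_n and ẽ_n

-- Closure under `≈` is a separate constructor because elements of 𝒫 are compared by their
-- coefficients only. The generators e start at index 1.
data Generated : 𝒫 → Set where
  e-gen : ∀ n → Generated (e (suc n))
  ẽ-gen : ∀ n → Generated (ẽ n)
  1-gen : Generated 1𝒫
  +-gen : ∀ {f g} → Generated f → Generated g → Generated (f +𝒫 g)
  *-gen : ∀ {f g} → Generated f → Generated g → Generated (f *𝒫 g)
  neg-gen : ∀ {f} → Generated f → Generated (-𝒫 f)
  ≈-gen  : ∀ {f g} → f ≈ g → Generated f → Generated g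

0-gen : Generated 0𝒫
0-gen = ≈-gen (λ m → ℤₚ.+-inverseʳ (𝟙 m)) (+-gen 1-gen (neg-gen 1-gen))

infixr 8 _·𝒫_
_·𝒫_ : ℤ → 𝒫 → 𝒫
c ·𝒫 f = record
  { coeff     = λ m → c * coeff f m
  ; stable    = λ m → cong (c *_) (stable f m)
  ; bounded   = proj₁ (bounded f) , λ m l → zero-*ʳ c (proj₂ (bounded f) m l)
  ; invariant = λ σ m → trans (cong (c *_) (invariant f σ m)) (sym (sgn-*ʳ (inversions σ m) c _))
  }

·-gen : ∀ c {f} → Generated f → Generated (c ·𝒫 f)
·-gen (ℤ.+ n) F = natural n F
  where
  natural : ∀ n {f} → Generated f → Generated ((ℤ.+ n) ·𝒫 f)
  natural zero    {f} F = ≈-gen (λ m → sym (ℤₚ.*-zeroˡ (coeff f m))) 0-gen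
  natural (suc n) {f} F = ≈-gen (λ m → sym (ℤₚ.suc-* (ℤ.+ n) (coeff f m))) (+-gen F (natural n F))
·-gen -[1+ n ] {f} F = ≈-gen (λ m → ℤₚ.neg-distribˡ-* (ℤ.+ suc n) (coeff f m)) (neg-gen (·-gen (ℤ.+ suc n) F))

-- The degree bound ensures that subtracting a multiple of `term` from a series does not raise the
-- degree bound of that series.
record LeadingTerm (p : Mon) : Set where
  field
    term       : 𝒫
    generated  : Generated term
    leading    : Leading p (coeff term)
    term-bound : BoundedBy (deg p) (coeff term)

open LeadingTerm

_*ᴸ_ : ∀ {r p q} → LeadingTerm p → LeadingTerm q → Splits r p q → LeadingTerm r
_*ᴸ_ {r} {p} {q} F G ρ = record
  { term       = term F *𝒫 term G
  ; generated  = *-gen (generated F) (generated G)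
  ; leading    = ⊛-leading ρ (leading F) (leading G)
  ; term-bound = subst (λ d → BoundedBy d (coeff (term F) ⊛ coeff (term G))) (sym (splits-deg ρ))
      (⊛-bounded {f = coeff (term F)} {coeff (term G)} (term-bound F) (term-bound G))
  }

deg-𝐱s : ∀ n p → deg (replicate n 𝐱 ++ p) ≡ n ℕ.+ deg p
deg-𝐱s zero    p = refl
deg-𝐱s (suc n) p = cong suc (deg-𝐱s n p)

deg-𝐨s : ∀ k → deg (𝐨s k) ≡ 0
deg-𝐨s zero    = refl
deg-𝐨s (suc k) = deg-𝐨s k

1-term : ∀ k → LeadingTerm (𝐨s k)
1-term k = record
  { term       = 1𝒫
  ; generated  = 1-gen
  ; leading    = 𝟙-leading k
  ; term-bound = λ m l → proj₂ (bounded 1𝒫) m (subst (_< deg m) (deg-𝐨s k) l)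
  }

e-term : ∀ n k → LeadingTerm (replicate (suc n) 𝐱 ++ 𝐨s k)
e-term n k = record
  { term       = e (suc n)
  ; generated  = e-gen n
  ; leading    = e-leading (suc n) k
  ; term-bound = λ m l → proj₂ (bounded (e (suc n))) m
      (subst (_< deg m) (trans (deg-𝐱s (suc n) (𝐨s k)) (cong (suc n ℕ.+_) (deg-𝐨s k))) l)
  }

ẽ-term : ∀ n k → LeadingTerm (replicate n 𝐱 ++ 𝛉 ∷ 𝐨s k)
ẽ-term n k = record
  { term       = ẽ n
  ; generated  = ẽ-gen n
  ; leading    = ẽ-leading n k
  ; term-bound = λ m l → proj₂ (bounded (ẽ n)) m
      (subst (_< deg m) (trans (deg-𝐱s n (𝛉 ∷ 𝐨s k)) (cong (λ z → n ℕ.+ suc z) (deg-𝐨s k))) l)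
  }

block : ℕ → ℕ → Mon → Mon
block n a q = replicate n (a , false) ++ q

block-∷ : ∀ n a q → block (suc n) a q ≡ block n a ((a , false) ∷ q)
block-∷ zero    a q = refl
block-∷ (suc n) a q = cong ((a , false) ∷_) (block-∷ n a q)

splits-𝐨s : ∀ q → Splits q (𝐨s (length q)) q
splits-𝐨s []                = []
splits-𝐨s ((a , false) ∷ q) = ff ∷ splits-𝐨s q
splits-𝐨s ((a , true) ∷ q)  = ft ∷ splits-𝐨s q

splits-block : ∀ n {a r p q} → Splits r p q → Splits (block n (suc a) r) (replicate n 𝐱 ++ p) (block n a q)
splits-block zero    ρ = ρ
splits-block (suc n) ρ = ff ∷ splits-block n ρ

raise : ∀ k n q {a} → LeadingTerm (block (suc n) a q) → LeadingTerm (block (suc n) (k ℕ.+ a) q)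
raise zero    n q L = L
raise (suc k) n q L = (e-term n (length q) *ᴸ raise k n q L) (splits-block (suc n) (splits-𝐨s q))

mark : ∀ {n a q} → LeadingTerm (block n a ((a , false) ∷ q)) → LeadingTerm (block n (suc a) ((a , true) ∷ q))
mark {n} {a} {q} L = (ẽ-term n (length q) *ᴸ L) (splits-block n (tf ∷ splits-𝐨s q))

top : Mon → ℕ
top []      = 0
top (v ∷ _) = degₛ v

-- The condition aᵢ ≥ aᵢ₊₁ + εᵢ₊₁, with 0 on the right after the last slot.
data Dominant : Mon → Set where
  []  : Dominant []
  _∷_ : ∀ {a ε p} → top p ≤ a → Dominant p → Dominant ((a , ε) ∷ p)

-- Multiplying by e_{n+1} raises the first n + 1 exponents, and by ẽ_n the first
-- n exponents while adding θ_{n+1}.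
block-term : ∀ {q} → Dominant q → ∀ n → LeadingTerm (block n (top q) q)
block-term []                    n = subst LeadingTerm (sym (Listₚ.++-identityʳ (𝐨s n))) (1-term n)
block-term {(a , ε) ∷ q} (l ∷ D) n = finish ε
  -- The block before `q` gets one extra slot and is raised from exponent `top q` to `a`; the extra
  -- slot then serves as the head (a , ε), its θ being added by `mark`.
  (subst LeadingTerm (trans (cong (λ c → block (suc n) c q) (ℕₚ.m∸n+n≡m l)) (block-∷ n a q))
    (raise (a ℕ.∸ top q) n q (block-term D (suc n))))
  where
  finish : ∀ ε → LeadingTerm (block n a ((a , false) ∷ q)) → LeadingTerm (block n (degₛ (a , ε)) ((a , ε) ∷ q))
  finish false L = subst (λ c → LeadingTerm (block n c ((a , false) ∷ q))) (sym (ℕₚ.+-identityʳ a)) L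
  finish true  L = subst (λ c → LeadingTerm (block n c ((a , true) ∷ q))) (ℕₚ.+-comm 1 a) (mark {n} L)

-- Leading monomials of invariant series

i≡-i⇒i≡0 : ∀ i → i ≡ - i → i ≡ 0ℤ
i≡-i⇒i≡0 (ℤ.+ zero) e = refl

degₛ≤ : ∀ a ε → degₛ (a , ε) ≤ suc a
degₛ≤ a false = ℕₚ.≤-trans (ℕₚ.≤-reflexive (ℕₚ.+-identityʳ a)) (ℕₚ.n≤1+n a)
degₛ≤ a true  = ℕₚ.≤-reflexive (ℕₚ.+-comm a 1)

-- Write v = (a , ε) and w = (b , η), where b + η > a. If a < b, then 2a + ε < 2b + η. Otherwise a =
-- b and η = 1, and the outcome depends on ε.
step-down : ∀ v w → ¬ degₛ w ≤ proj₁ v → rank v < rank w ⊎ (v ≡ w × odd v ≡ true)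
step-down (a , ε) (b , η) n with ℕₚ.<-cmp a b
... | tri< l _ _ = inj₁ (ℕₚ.+-mono-<-≤ l (ℕₚ.≤-trans (degₛ≤ a ε) (ℕₚ.≤-trans l (ℕₚ.m≤m+n b _))))
... | tri> _ _ l = contradiction (ℕₚ.≤-trans (degₛ≤ b η) l) n
step-down (a , ε)     (a , false) n | tri≈ _ refl _ = contradiction (ℕₚ.≤-reflexive (ℕₚ.+-identityʳ a)) n
step-down (a , false) (a , true)  n | tri≈ _ refl _ = inj₁ (ℕₚ.+-monoʳ-< a (ℕₚ.+-monoʳ-< a (s≤s z≤n)))
step-down (a , true)  (a , true)  n | tri≈ _ refl _ = inj₂ (refl , refl)

-- A violation at the first two slots is treated by exchanging them; one further on is treated in
-- `f ⟨ v ⟩`, which inherits both the symmetry and the vanishing.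
dominant? : ∀ p → Dominant p ⊎ (∀ f → Adjacent f → VanishesAbove p f → f p ≡ 0ℤ)
dominant? [] = inj₁ []
dominant? (v ∷ p) with dominant? p
... | inj₂ z = inj₂ λ f adj F → z (f ⟨ v ⟩) (Adjacent-tail {f} adj v) λ m l r → F (v ∷ m) (cong suc l) (there r)
dominant? (v ∷ []) | inj₁ D = inj₁ (z≤n ∷ D)
dominant? (v ∷ w ∷ p) | inj₁ D with degₛ w ℕ.≤? proj₁ v
... | yes l = inj₁ (l ∷ D)
... | no n  = inj₂ λ f adj F → go f adj F (step-down v w n)
  where
  go : ∀ f → Adjacent f → VanishesAbove (v ∷ w ∷ p) f → rank v < rank w ⊎ (v ≡ w × odd v ≡ true) → f (v ∷ w ∷ p) ≡ 0ℤ
  go f adj F (inj₁ l) = trans (sym (adj 0 (v ∷ w ∷ p)))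
    (trans (cong ([-1]^ (odd v ∧ odd w) ·_) (F (w ∷ v ∷ p) refl (here l))) (sgn-0 (odd v ∧ odd w)))
  go f adj F (inj₂ (refl , o)) = i≡-i⇒i≡0 (f (v ∷ v ∷ p))
    (trans (sym (adj 0 (v ∷ v ∷ p))) (cong (λ b → [-1]^ (b ∧ b) · f (v ∷ v ∷ p)) o))

-- Descending induction for the lexicographic order on the monomials of length
-- k, where K S means that a claim holds for all series vanishing on S.
lex-induction : ∀ B k (K : (Mon → Set) → Set) →
  (∀ {S T : Mon → Set} → (∀ m → length m ≡ k → All (λ v → rank v < B) m → S m → T m) → K S → K T) →
  (∀ p → length p ≡ k → K (λ m → p ≺ m ⊎ p ≡ m) → K (p ≺_)) →
  K (λ _ → ⊤) → K (λ _ → ⊥)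
lex-induction B zero K mono step K⊤ =
  mono (λ { [] _ _ () }) (step [] refl (mono (λ { [] _ _ _ → inj₂ refl }) K⊤))
-- All ranks are below B, so `Head≥ B` is empty on the relevant monomials.
lex-induction B (suc k) K mono step K⊤ = mono (λ { (u ∷ m) _ (l ∷ _) n → ℕₚ.<⇒≱ l n }) (heads B)
  where
  Above : Slot → (Mon → Set) → Mon → Set
  Above v S []      = ⊥
  Above v S (u ∷ m) = rank v < rank u ⊎ (v ≡ u × S m)

  Head≥ : ℕ → Mon → Set
  Head≥ n []      = ⊥
  Head≥ n (u ∷ m) = n ≤ rank u

  -- Induction over the tails behind the fixed head v passes from vanishing at all heads of rank at
  -- least that of v to vanishing only at those strictly above.
  next : ∀ v → K (Above v (λ _ → ⊤)) → K (Above v (λ _ → ⊥))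
  next v = lex-induction B k (K ∘ Above v)
    (λ h → mono λ { (u ∷ m) l (_ ∷ s) (inj₁ r) → inj₁ r ; (u ∷ m) l (_ ∷ s) (inj₂ (e , z)) → inj₂ (e , h m (ℕₚ.suc-injective l) s z) })
    (λ p l K≥ → mono
      (λ { (u ∷ m) _ _ (here r) → inj₁ r ; (u ∷ m) _ _ (there r) → inj₂ (refl , r) })
      (step (v ∷ p) (cong suc l) (mono
        (λ { (u ∷ m) _ _ (inj₁ r) → inj₁ (here r)
           ; (u ∷ m) _ _ (inj₂ (refl , inj₁ r)) → inj₁ (there r)
           ; (u ∷ m) _ _ (inj₂ (refl , inj₂ refl)) → inj₂ refl }) K≥)))

  heads : ∀ n → K (Head≥ n)
  heads zero    = mono (λ { (u ∷ m) _ _ _ → z≤n }) K⊤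
  heads (suc n) = mono (λ { (u ∷ m) _ _ (inj₁ r) → subst (_< rank u) (rank-unrank n) r })
    (next (unrank n) (mono (λ { (u ∷ m) _ _ l → split u l }) (heads n)))
    where
    split : ∀ u → n ≤ rank u → rank (unrank n) < rank u ⊎ (unrank n ≡ u × ⊤)
    split u l with ℕₚ.m≤n⇒m<n∨m≡n l
    ... | inj₁ r = inj₁ (subst (_< rank u) (sym (rank-unrank n)) r)
    ... | inj₂ e = inj₂ (trans (cong unrank e) (unrank-rank u) , tt)

-- Determination of a series by its monomials of a fixed length

drop-𝐨 : ∀ {f} → Adjacent f → Stable f → ∀ p q → f (p ++ 𝐨 ∷ q) ≡ f (p ++ q)
drop-𝐨     adj st []      []      = st []
-- The trivial slot is even, so it moves past `v` without a sign until stability removes it at the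
-- end.
drop-𝐨 {f} adj st []      (v ∷ q) = trans (sym (adj 0 (𝐨 ∷ v ∷ q))) (drop-𝐨 {f ⟨ v ⟩} (Adjacent-tail {f} adj v) (λ m → st (v ∷ m)) [] q)
drop-𝐨 {f} adj st (v ∷ p) q       = drop-𝐨 {f ⟨ v ⟩} (Adjacent-tail {f} adj v) (λ m → st (v ∷ m)) p q

-- Pigeonhole principle: each slot other than `𝐨` contributes at least 1 to the degree.
find-𝐨 : ∀ m → deg m < length m → ∃₂ λ p q → m ≡ p ++ 𝐨 ∷ q
find-𝐨 (v ∷ m) l with v ≟ₛ 𝐨
... | yes refl = [] , m , refl
... | no n with find-𝐨 m (ℕₚ.+-cancelˡ-< 1 _ _ (ℕₚ.≤-<-trans (ℕₚ.+-monoˡ-≤ (deg m) (positive v n)) l))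
  where
  positive : ∀ v → v ≢ 𝐨 → 1 ≤ degₛ v
  positive (zero , false) n = contradiction refl n
  positive (zero , true)  n = s≤s z≤n
  positive (suc _ , _)    n = s≤s z≤n
...   | p , q , refl = v ∷ p , q , refl

vanishing : ∀ d f → BoundedBy d (coeff f) → (∀ m → length m ≡ d → coeff f m ≡ 0ℤ) → f ≈ 0𝒫
vanishing d f b z m with ℕₚ.≤-total (length m) d
... | inj₁ l = pad (d ℕ.∸ length m) m (ℕₚ.m∸n+n≡m l)
  where
  pad : ∀ k m → k ℕ.+ length m ≡ d → coeff f m ≡ 0ℤ
  pad zero    m e = z m e
  pad (suc k) m e = trans (sym (stable f m)) (pad k (m ∷ʳ 𝐨)
    (trans (cong (k ℕ.+_) (Listₚ.length-++-comm m (𝐨 ∷ []))) (trans (ℕₚ.+-suc k (length m)) e)))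
... | inj₂ l = shrink (length m ℕ.∸ d) m (sym (ℕₚ.m∸n+n≡m l))
  where
  shrink : ∀ k m → length m ≡ k ℕ.+ d → coeff f m ≡ 0ℤ
  shrink zero    m e = z m e
  shrink (suc k) m e with deg m ℕ.≤? d
  ... | no n = b m (ℕₚ.≰⇒> n)
  ... | yes l with find-𝐨 m (ℕₚ.≤-<-trans l (subst (d <_) (sym e) (s≤s (ℕₚ.m≤n+m d k))))
  ...   | p , q , refl = trans (drop-𝐨 {coeff f} (invariant⇒adjacent (invariant f)) (stable f) p q)
            (shrink k (p ++ q) (ℕₚ.suc-injective (trans (sym (Listₚ.length-++-sucʳ p 𝐨 q)) e)))

-- Gauss's algorithm

reduce : ∀ d p f → BoundedBy d (coeff f) → VanishesAbove p (coeff f) →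
  (∀ g → BoundedBy d (coeff g) → VanishesAbove p (coeff g) → coeff g p ≡ 0ℤ → Generated g) → Generated f
reduce d p f b F rec with coeff f p ℤ.≟ 0ℤ
... | yes z = rec f b F z
... | no nz with dominant? p
...   | inj₂ z = contradiction (z (coeff f) (invariant⇒adjacent (invariant f)) F) nz
...   | inj₁ D = ≈-gen (λ m → cancel (coeff f m) (c * coeff G m)) (+-gen (rec g g-bound g-vanishes g-zero) cG-gen)
  where
  L = block-term D 0
  G = term L
  -- The coefficient of G at p is ±1, hence its own inverse, so c G has the same coefficient at p as
  -- f.
  c = coeff f p * coeff G p
  cG-gen = ·-gen c (generated L)
  g = f +𝒫 (-𝒫 (c ·𝒫 G))
  cancel : ∀ i j → (i - j) + j ≡ i
  cancel i j = trans (ℤₚ.+-assoc i (- j) j) (trans (cong (i +_) (ℤₚ.+-inverseˡ j)) (ℤₚ.+-identityʳ i))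
  vanish : ∀ m → coeff f m ≡ 0ℤ → coeff G m ≡ 0ℤ → coeff g m ≡ 0ℤ
  vanish m e₁ e₂ = cong₂ _-_ e₁ (zero-*ʳ c e₂)
  -- The coefficient of f at p is nonzero, so p respects the degree bound of f, and therefore so
  -- does G.
  p≤d : deg p ≤ d
  p≤d with deg p ℕ.≤? d
  ... | yes l = l
  ... | no n  = contradiction (b p (ℕₚ.≰⇒> n)) nz
  g-bound : BoundedBy d (coeff g)
  g-bound m l = vanish m (b m l) (term-bound L m (ℕₚ.≤-<-trans p≤d l))
  g-vanishes : VanishesAbove p (coeff g)
  g-vanishes m l r = vanish m (F m l r) (vanishes (leading L) m l r)
  g-zero : coeff g p ≡ 0ℤ
  g-zero = trans (cong (λ z → coeff f p - z) (trans (ℤₚ.*-assoc (coeff f p) (coeff G p) (coeff G p))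
    (trans (cong (coeff f p *_) (unit (leading L))) (ℤₚ.*-identityʳ (coeff f p))))) (ℤₚ.+-inverseʳ (coeff f p))

generation : ∀ f → Generated f
-- By `vanishing`, monomials with d slots suffice; a slot of degree at most d has rank at most 2d.
generation f = lex-induction (suc (d ℕ.+ d)) d K mono step
  (λ g b z → ≈-gen (λ m → sym (vanishing d g b (λ m l → z m l tt) m)) 0-gen) f (proj₂ (bounded f)) (λ m l ())
  where
  d = proj₁ (bounded f)
  K : (Mon → Set) → Set
  K S = ∀ g → BoundedBy d (coeff g) → (∀ m → length m ≡ d → S m → coeff g m ≡ 0ℤ) → Generated g
  small : ∀ m → deg m ≤ d → All (λ v → rank v < suc (d ℕ.+ d)) m
  small []      l = []
  small (v ∷ m) l = s≤s (ℕₚ.+-mono-≤ (ℕₚ.≤-trans (ℕₚ.m≤m+n (proj₁ v) _) v≤d) v≤d) ∷ small m (ℕₚ.m+n≤o⇒n≤o (degₛ v) l)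
    where v≤d = ℕₚ.m+n≤o⇒m≤o (degₛ v) l
  mono : ∀ {S T : Mon → Set} → (∀ m → length m ≡ d → All (λ v → rank v < suc (d ℕ.+ d)) m → S m → T m) → K S → K T
  mono {S} S⊆T KS g b z = KS g b go
    where
    go : ∀ m → length m ≡ d → S m → coeff g m ≡ 0ℤ
    -- Above degree d the coefficient is 0 anyway, so the inclusion is required only where the ranks
    -- are bounded.
    go m l s with deg m ℕ.≤? d
    ... | yes le = z m l (S⊆T m l (small m le) s)
    ... | no n   = b m (ℕₚ.≰⇒> n)
  step : ∀ p → length p ≡ d → K (λ m → p ≺ m ⊎ p ≡ m) → K (p ≺_)
  step p l K≥ g b z = reduce d p g b (λ m e r → z m (trans e l) r) λ g′ b′ F′ z′ → K≥ g′ b′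
    λ { m e (inj₁ r) → F′ m (trans e (sym l)) r ; m e (inj₂ refl) → z′ }

-- Involutivity of ω̂

h₀≈1 : h 0 ≈ 1𝒫
-- At the slot `𝐨` the relation reads e₀ h₀ = 1, where e₀ = 1.
h₀≈1 m = trans (sym (⊛-identityˡ (coeff (h 0)) m)) (trans (⊛-congˡ (coeff (h 0)) (λ q → sym (e₀≈1 q)) m) (e-h-relation 𝐨 m))

theorem20 : (ω̂ : 𝒫 → 𝒫) →
    RingMorphisms.IsRingHomomorphism (Ring.rawRing 𝒫-ring) (Ring.rawRing 𝒫-ring) ω̂ →
    (∀ (n : ℕ) → ω̂ (e (suc n)) ≈ h (suc n)) →
    (∀ (n : ℕ) → ω̂ (ẽ n) ≈ h̃ n) →
    (∀ (f : 𝒫) → ω̂ (ω̂ f) ≈ f) × (∀ (n : ℕ) → ω̂ (h n) ≈ e n) × (∀ (n : ℕ) → ω̂ (h̃ n) ≈ ẽ n)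
theorem20 ω̂ hom ω̂e ω̂ẽ = (λ f → involutive (generation f)) , (λ n → h↦e (n , false)) , (λ n → h↦e (n , true))
  where
  open RingMorphisms.IsRingHomomorphism hom

  e↦h : ∀ v → ω̂ (extract factorsE v) ≈ extract factorsH v
  -- The hypothesis on the e's starts at index 1; at index 0 both series are 1, which a ring
  -- homomorphism preserves.
  e↦h (zero , false) m = trans (⟦⟧-cong e₀≈1 m) (trans (1#-homo m) (sym (h₀≈1 m)))
  e↦h (suc n , false)  = ω̂e n
  e↦h (n , true)       = ω̂ẽ n

  h↦e : ∀ v → ω̂ (extract factorsH v) ≈ extract factorsE v
  h↦e = ω̂-H ω̂ hom e↦h

  twice : ∀ v → ω̂ (ω̂ (extract factorsE v)) ≈ extract factorsE v
  twice v m = trans (⟦⟧-cong (e↦h v) m) (h↦e v m)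

  involutive : ∀ {f} → Generated f → ω̂ (ω̂ f) ≈ f
  involutive (e-gen n) = twice (suc n , false)
  involutive (ẽ-gen n) = twice (n , true)
  involutive 1-gen m = trans (⟦⟧-cong 1#-homo m) (1#-homo m)
  involutive (+-gen {f} {g} F G) m = trans (⟦⟧-cong (+-homo f g) m)
    (trans (+-homo (ω̂ f) (ω̂ g) m) (cong₂ _+_ (involutive F m) (involutive G m)))
  involutive (*-gen {f} {g} F G) m = trans (⟦⟧-cong (*-homo f g) m)
    (trans (*-homo (ω̂ f) (ω̂ g) m) (⊛-congˡʳ (involutive F) (involutive G) m))
  involutive (neg-gen {f} F) m = trans (⟦⟧-cong (-‿homo f) m)
    (trans (-‿homo (ω̂ f) m) (cong -_ (involutive F m)))
  involutive (≈-gen {f} {g} f≈g F) m = trans (sym (⟦⟧-cong (⟦⟧-cong {f} {g} f≈g) m)) (trans (involutive F m) (f≈g m))
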